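{- Let $\mathcal{U}$ be a unital of order $q$ and let $\mathcal{S}$ be a maximal Erdős-Ko-Rado set on $\mathcal{U}$. If $q\geq5$, then either $|\mathcal{S}|=q^{2}$ and $\mathcal{S}$ is a point-pencil, or else $|\mathcal{S}|\leq q^{2}-q+\sqrt[3]{q^{2}}-\frac{2}{3}\sqrt[3]{q}+1$. If $q=4$, then either $|\mathcal{S}|=16=q^{2}$ and $\mathcal{S}$ is a point-pencil, or else $|\mathcal{S}|\leq 13=q^{2}-q+1$. If $q=3$, then either $|\mathcal{S}|=9=q^{2}$ and $\mathcal{S}$ is a point-pencil, or else $|\mathcal{S}|\leq 8$.
   Context: A $2-(v,k,1)$ design, with integers $v>k>1$, consists of a set $\mathcal{P}$ of $v$ points together with a set $\mathcal{B}$ of $k$-subsets of $\mathcal{P}$ (blocks) such that any two distinct points are contained in exactly one block. A unital of order $q$, $q\geq 2$ an integer, is a $2-(q^{3}+1,q+1,1)$ design. An Erdős-Ko-Rado set on a design is a set of pairwise intersecting blocks; it is maximal if it cannot be extended to a larger Erdős-Ko-Rado set of the design. A point-pencil is the set of all blocks through a fixed point. -}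

module Defs where

open import Data.Bool using (true; false; T; if_then_else_)
open import Data.Nat as ℕ using (ℕ; zero; suc; s≤s; z≤n)
import Data.Nat.Properties as ℕ
import Data.Nat.Solver as ℕ
open import Data.Integer as ℤ using (+_; +[1+_])
import Data.Integer.Properties as ℤ
import Data.Integer.Solver as ℤ
open import Data.Rational.Unnormalised
open import Data.Rational.Unnormalised.Properties
open import Data.Rational.Unnormalised.Solver using (module +-*-Solver)
open import Data.Fin using (Fin)
open import Data.Fin.Subset as Subset using (Subset; _∈_; _⊂_; _∩_; Nonempty)
open import Data.Product using (∃; ∃!; _×_; _,_; proj₁; proj₂)
open import Data.Sum using (inj₁; inj₂)
open import Function using (_⇔_; Injective)
open import Relation.Nullary using (¬_)
open import Relation.Binary.PropositionalEquality as ≡ using (_≡_; _≢_; refl)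

-- The points are Fin v and the blocks are enumerated without repetition by
-- Fin b, so that sets of points and sets of blocks both have a cardinality
-- Subset.∣_∣.
record Design (v k : ℕ) : Set where
  field
    1<k             : 1 ℕ.< k
    k<v             : k ℕ.< v
    b               : ℕ
    block           : Fin b → Subset v
    block-injective : Injective _≡_ _≡_ block
    block-size      : ∀ i → Subset.∣ block i ∣ ≡ k
    joining-block   : ∀ {x y} → x ≢ y →
                      ∃! _≡_ λ i → x ∈ block i × y ∈ block i

  -- The case i ≡ j imposes nothing, since blocks have k > 1 points.
  IsEKR : Subset b → Set
  IsEKR S = ∀ {i j} → i ∈ S → j ∈ S → Nonempty (block i ∩ block j)

  IsMaximalEKR : Subset b → Set
  IsMaximalEKR S = IsEKR S × ¬ (∃ λ T → IsEKR T × S ⊂ T)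

  IsPointPencil : Subset b → Set
  IsPointPencil S = ∃ λ x → ∀ i → i ∈ S ⇔ x ∈ block i

record Unital (q : ℕ) : Set where
  field
    2≤q    : 2 ℕ.≤ q
    design : Design (q ℕ.^ 3 ℕ.+ 1) (q ℕ.+ 1)

  open Design design public

-- Real numbers are Cauchy sequences of rationals. Distinct sequences may
-- represent the same number, which the order below does not distinguish.
IsCauchy : (ℕ → ℚᵘ) → Set
IsCauchy x = ∀ ε → 0ℚᵘ < ε →
  ∃ λ N → ∀ m n → N ℕ.≤ m → N ℕ.≤ n → ∣ x m - x n ∣ < ε

record ℝ : Set where
  constructor mkℝ
  field
    seq    : ℕ → ℚᵘ
    cauchy : IsCauchy seq

open ℝ public

infix  4 _<ᴿ_ _≤ᴿ_
infixl 6 _+ᴿ_ _-ᴿ_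
infixl 7 _·ᴿ_

_<ᴿ_ : ℝ → ℝ → Set
x <ᴿ y = ∃ λ ε → 0ℚᵘ < ε × ∃ λ N → ∀ n → N ℕ.≤ n → seq x n + ε ≤ seq y n

_≤ᴿ_ : ℝ → ℝ → Set
x ≤ᴿ y = ¬ (y <ᴿ x)

private
  half-pos : ∀ {ε} → 0ℚᵘ < ε → 0ℚᵘ < ½ * ε
  half-pos {ε} 0<ε = <-respˡ-≃ (*-zeroʳ ½) (*-monoʳ-<-pos ½ 0<ε)

  halves : ∀ ε → ½ * ε + ½ * ε ≃ ε
  halves ε = ≃-trans (≃-sym (*-distribʳ-+ ε ½ ½))
                     (≃-trans (*-congʳ {ε} {½ + ½} {1ℚᵘ} (*≡* refl)) (*-identityˡ ε))

fromℚ : ℚᵘ → ℝ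
fromℚ p = mkℝ (λ _ → p) λ ε 0<ε → 0 , λ _ _ _ _ →
  <-respˡ-≃ (≃-sym (∣-∣-cong (+-inverseʳ p))) 0<ε

fromℕ : ℕ → ℝ
fromℕ n = fromℚ (+ n / 1)

_+ᴿ_ : ℝ → ℝ → ℝ
x +ᴿ y = mkℝ (λ n → seq x n + seq y n) λ ε 0<ε →
  let M , x-close = cauchy x (½ * ε) (half-pos 0<ε)
      N , y-close = cauchy y (½ * ε) (half-pos 0<ε)
  in M ℕ.⊔ N , λ m n m≥ n≥ →
    let δx = seq x m - seq x n
        δy = seq y m - seq y n
    in <-respˡ-≃
         (∣-∣-cong (solve 4 (λ a b c d →
            (a :- b) :+ (c :- d) := (a :+ c) :- (b :+ d)) ≃-refl
            (seq x m) (seq x n) (seq y m) (seq y n)))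
         (≤-<-trans (∣p+q∣≤∣p∣+∣q∣ δx δy)
           (<-respʳ-≃ (halves ε)
             (+-mono-< (x-close m n (ℕ.m⊔n≤o⇒m≤o M N m≥) (ℕ.m⊔n≤o⇒m≤o M N n≥))
                       (y-close m n (ℕ.m⊔n≤o⇒n≤o M N m≥) (ℕ.m⊔n≤o⇒n≤o M N n≥)))))
  where open +-*-Solver

_·ᴿ_ : ℚᵘ → ℝ → ℝ
c ·ᴿ x = mkℝ (λ n → c * seq x n) λ ε 0<ε →
  let instance C>0 = positive (0<C)
               C≢0 = pos⇒nonZero C
               1/C>0 = 1/pos⇒pos C
      N , close = cauchy x (1/ C * ε)
        (<-respˡ-≃ (*-zeroʳ (1/ C)) (*-monoʳ-<-pos (1/ C) 0<ε))
  in N , λ m n m≥ n≥ →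
    let δ = seq x m - seq x n in
    <-respˡ-≃
      (∣-∣-cong (solve 3 (λ c a b → c :* (a :- b) := c :* a :- c :* b) ≃-refl
         c (seq x m) (seq x n)))
      (≤-<-trans
        (≤-respˡ-≃ (≃-sym (∣p*q∣≃∣p∣*∣q∣ c δ))
          (*-monoˡ-≤-nonNeg ∣ δ ∣ {{nonNegative (0≤∣p∣ δ)}} (p≤p+q ∣ c ∣ 1ℚᵘ)))
        (<-respʳ-≃ (cancel ε) (*-monoʳ-<-pos C (close m n m≥ n≥))))
  where
  open +-*-Solver
  C = ∣ c ∣ + 1ℚᵘ

  0<C : 0ℚᵘ < C
  0<C = +-mono-≤-< (0≤∣p∣ c) (positive⁻¹ 1ℚᵘ)

  cancel : ∀ ε .{{_ : NonZero C}} → C * (1/ C * ε) ≃ ε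
  cancel ε = ≃-trans (≃-sym (*-assoc C (1/ C) ε))
    (≃-trans (*-congʳ {ε} (*-inverseʳ C)) (*-identityˡ ε))

_-ᴿ_ : ℝ → ℝ → ℝ
x -ᴿ y = x +ᴿ (- 1ℚᵘ) ·ᴿ y

⌊∛_⌋ : ℕ → ℕ
⌊∛ zero ⌋  = 0
⌊∛ suc n ⌋ =
  if suc ⌊∛ n ⌋ ℕ.^ 3 ℕ.≤ᵇ suc n then suc ⌊∛ n ⌋ else ⌊∛ n ⌋

⌊∛⌋-bounds : ∀ n → ⌊∛ n ⌋ ℕ.^ 3 ℕ.≤ n × n ℕ.< suc ⌊∛ n ⌋ ℕ.^ 3
⌊∛⌋-bounds zero = z≤n , s≤s z≤n
⌊∛⌋-bounds (suc n) with suc ⌊∛ n ⌋ ℕ.^ 3 ℕ.≤ᵇ suc n in eq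
... | true  =
  ℕ.≤ᵇ⇒≤ _ _ (≡.subst T (≡.sym eq) _) ,
  ℕ.≤-<-trans (proj₂ (⌊∛⌋-bounds n)) (ℕ.^-monoˡ-< 3 (ℕ.n<1+n (suc ⌊∛ n ⌋)))
... | false =
  ℕ.m≤n⇒m≤1+n (proj₁ (⌊∛⌋-bounds n)) ,
  ℕ.≰⇒> λ le → ≡.subst T eq (ℕ.≤⇒≤ᵇ le)

-- Writing M = m + 1, the approximation a = ⌊∛(n M³)⌋ / M satisfies
-- a³ ≤ n < (a + 1/M)³ by ⌊∛⌋-bounds.
∛-approx : ℕ → ℕ → ℚᵘ
∛-approx n m = + ⌊∛ n ℕ.* suc m ℕ.^ 3 ⌋ / suc m

private
  cube-* : ∀ a b → (a ℕ.* b) ℕ.^ 3 ≡ a ℕ.^ 3 ℕ.* b ℕ.^ 3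
  cube-* = solve 2 (λ a b → (a :* b) :^ 3 := a :^ 3 :* b :^ 3) refl
    where open ℕ.+-*-Solver

  cube-cancel-< : ∀ {a b} → a ℕ.^ 3 ℕ.< b ℕ.^ 3 → a ℕ.< b
  cube-cancel-< a³<b³ = ℕ.≰⇒> λ b≤a → ℕ.<⇒≱ a³<b³ (ℕ.^-monoˡ-≤ 3 b≤a)

  ⌊∛⌋-scaled : ∀ n m k →
    ⌊∛ n ℕ.* suc m ℕ.^ 3 ⌋ ℕ.* suc k ℕ.< suc ⌊∛ n ℕ.* suc k ℕ.^ 3 ⌋ ℕ.* suc m
  ⌊∛⌋-scaled n m k = cube-cancel-< (begin-strict
    (r ℕ.* K) ℕ.^ 3             ≡⟨ cube-* r K ⟩
    r ℕ.^ 3 ℕ.* K ℕ.^ 3         ≤⟨ ℕ.*-monoˡ-≤ (K ℕ.^ 3) (proj₁ (⌊∛⌋-bounds (n ℕ.* M ℕ.^ 3))) ⟩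
    n ℕ.* M ℕ.^ 3 ℕ.* K ℕ.^ 3   ≡⟨ swap n (M ℕ.^ 3) (K ℕ.^ 3) ⟩
    n ℕ.* K ℕ.^ 3 ℕ.* M ℕ.^ 3   <⟨ ℕ.*-monoˡ-< (M ℕ.^ 3) {{ℕ.m^n≢0 M 3}} (proj₂ (⌊∛⌋-bounds (n ℕ.* K ℕ.^ 3))) ⟩
    suc s ℕ.^ 3 ℕ.* M ℕ.^ 3     ≡⟨ cube-* (suc s) M ⟨
    (suc s ℕ.* M) ℕ.^ 3         ∎)
    where
    open ℕ.≤-Reasoning
    M = suc m
    K = suc k
    r = ⌊∛ n ℕ.* M ℕ.^ 3 ⌋
    s = ⌊∛ n ℕ.* K ℕ.^ 3 ⌋
    swap : ∀ a b c → a ℕ.* b ℕ.* c ≡ a ℕ.* c ℕ.* b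
    swap = solve 3 (λ a b c → a :* b :* c := a :* c :* b) refl
      where open ℕ.+-*-Solver

  ∛-approx-close : ∀ n m k → ∛-approx n m < ∛-approx n k + + 1 / suc k
  ∛-approx-close n m k = <-respʳ-≃ {∛-approx n m} {+ suc s / suc k} (*≡* lemma)
    (*<* (≡.subst₂ ℤ._<_ (ℤ.pos-* r (suc k)) (ℤ.pos-* (suc s) (suc m))
      (ℤ.+<+ (⌊∛⌋-scaled n m k))))
    where
    open ℤ.+-*-Solver
    r = ⌊∛ n ℕ.* suc m ℕ.^ 3 ⌋
    s = ⌊∛ n ℕ.* suc k ℕ.^ 3 ⌋
    lemma : + suc s ℤ.* + (suc k ℕ.* suc k) ≡
            (+ s ℤ.* + suc k ℤ.+ + 1 ℤ.* + suc k) ℤ.* + suc k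
    lemma = ≡.trans (≡.cong (+ suc s ℤ.*_) (ℤ.pos-* (suc k) (suc k)))
      (solve 2 (λ s K → (con (+ 1) :+ s) :* (K :* K) :=
                        (s :* K :+ con (+ 1) :* K) :* K) refl (+ s) (+ suc k))

  1/suc≤ : ∀ n d k → d ℕ.≤ k → + 1 / suc k ≤ mkℚᵘ +[1+ n ] d
  1/suc≤ n d k d≤k = *≤* (ℤ.+≤+
    (≡.subst (ℕ._≤ suc n ℕ.* suc k) (≡.sym (ℕ.*-identityˡ (suc d)))
      (ℕ.≤-trans (s≤s d≤k) (ℕ.m≤n*m (suc k) (suc n)))))

  p<q+ε⇒p-q<ε : ∀ {p q ε} → p < q + ε → p - q < ε
  p<q+ε⇒p-q<ε {p} {q} {ε} p<q+ε =
    <-respʳ-≃ (solve 2 (λ q e → q :+ e :- q := e) ≃-refl q ε) (+-monoˡ-< (- q) p<q+ε)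
    where open +-*-Solver

  ∣p-q∣<ε : ∀ {p q ε} → p < q + ε → q < p + ε → ∣ p - q ∣ < ε
  ∣p-q∣<ε {p} {q} {ε} p<q+ε q<p+ε with ∣p∣≡p∨∣p∣≡-p (p - q)
  ... | inj₁ eq = ≡.subst (_< ε) (≡.sym eq) (p<q+ε⇒p-q<ε p<q+ε)
  ... | inj₂ eq = ≡.subst (_< ε) (≡.sym eq)
    (<-respˡ-≃ (solve 2 (λ p q → q :- p := :- (p :- q)) ≃-refl p q) (p<q+ε⇒p-q<ε q<p+ε))
    where open +-*-Solver

  ∛-approx-cauchy : ∀ n → IsCauchy (∛-approx n)
  ∛-approx-cauchy n ε@(mkℚᵘ +[1+ a ] d) _ = d , λ m k d≤m d≤k →
    ∣p-q∣<ε (close m k d≤k) (close k m d≤m)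
    where
    close : ∀ m k → d ℕ.≤ k → ∛-approx n m < ∛-approx n k + ε
    close m k d≤k = <-≤-trans (∛-approx-close n m k)
      (+-monoʳ-≤ (∛-approx n k) (1/suc≤ a d k d≤k))
  ∛-approx-cauchy n (mkℚᵘ (+ 0) d) (*<* (ℤ.+<+ ()))
  ∛-approx-cauchy n (mkℚᵘ ℤ.-[1+ a ] d) (*<* ())

∛ : ℕ → ℝ
∛ n = mkℝ (∛-approx n) (∛-approx-cauchy n)

module Submission where

-- Let N = |S| = q² - q + x, and suppose that no point lies on all blocks of S.
-- If X is a set of q² + u points containing every block of S, then summing
-- (t - 1)(t - 2) ≥ 0 over the traces t = |B ∩ X| of all blocks B, those in S
-- having t = q + 1, gives x q (q - 1) ≤ u (u - 1).  A point P lies on s P ≤ q + 1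
-- blocks of S.  If s P = q + 1 for some P, then all blocks of S lie in the union of
-- those through P, so u = q + 1 and x is at most 1 (2 when q = 3).  Otherwise
-- take for X the union of S.  On it x ≤ s ≤ q, and summing (s - x)(q - s) ≥ 0
-- gives u x ≤ q x + (q - x)(q - 1 - x).  Eliminating u leaves
-- x³ + (2 q - 1) x ≤ 3 x² + q (q - 1), which fails for
-- x > ∛(q²) - (2/3) ∛q + 1 when q ≥ 5.

open import Defs
open import Data.Nat
  using (ℕ; zero; suc; _≤_; _<_; _^_; _+_; _*_; _∸_; _⊓_; z≤n; s≤s; _≟_; _≤?_)
open import Data.Nat.Properties hiding (_≟_; _≤?_)
open import Data.Nat.Tactic.RingSolver using (solve-∀)
open import Data.Integer using (+_; +[1+_])
import Data.Integer as ℤ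
import Data.Integer.Properties as ℤ
import Data.Integer.Tactic.RingSolver as ℤ-Solver
open import Data.Rational.Unnormalised using (_/_)
import Data.Rational.Unnormalised as ℚ
import Data.Rational.Unnormalised.Properties as ℚ
import Data.Rational.Unnormalised.Solver as ℚ
open import Data.Bool using (if_then_else_; true; false)
open import Data.Empty using (⊥)
open import Data.Fin using (Fin; zero; suc)
import Data.Fin.Properties as Fin
open import Data.Fin.Subset using (Subset; ∣_∣; _∈_; _∉_)
open import Data.Fin.Subset.Properties using (_∈?_; x∈p∩q⁻; x∈p∩q⁺)
open import Data.Product using (_×_; _,_; ∃; proj₁; proj₂)
open import Data.Sum using (_⊎_; inj₁; inj₂; [_,_]′; map; map₂)
open import Data.Vec using (lookup; tabulate; []; _∷_)
open import Data.Vec.Properties using ([]=⇒lookup; lookup⇒[]=; lookup∘tabulate)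
open import Function using (_∘_; _⇔_; mk⇔)
open import Relation.Nullary using (¬_; yes; no; contradiction)
open import Relation.Nullary.Decidable using (_→-dec_; decidable-stable; from-no)
open import Relation.Binary.PropositionalEquality
  using (_≡_; _≢_; refl; sym; trans; cong; cong₂; subst; subst₂; module ≡-Reasoning)
open import Algebra.Properties.Semiring.Sum +-*-semiring
  using (sum; sum-syntax; sum-cong-≗; sum-replicate-zero; ∑-distrib-+; ∑-comm; *-distribˡ-sum; *-distribʳ-sum)

-- The shape a + r + s ≡ b + l, with slack s, avoids subtraction: it is a semiring
-- identity even when a ≤ b follows from l ≤ r only after cancellation.
≤-by-certificate : ∀ {l r a b} s → l ≤ r → a + r + s ≡ b + l → a ≤ b
≤-by-certificate {l} {r} {a} {b} s l≤r eq = +-cancelʳ-≤ r a b (begin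
  a + r      ≤⟨ m≤m+n (a + r) s ⟩
  a + r + s  ≡⟨ eq ⟩
  b + l      ≤⟨ +-monoʳ-≤ b l≤r ⟩
  b + r      ∎)
  where open ≤-Reasoning

-- Finite sums

∑-mono : ∀ {n} {f g : Fin n → ℕ} → (∀ i → f i ≤ g i) → sum f ≤ sum g
∑-mono {zero}  f≤g = z≤n
∑-mono {suc n} f≤g = +-mono-≤ (f≤g zero) (∑-mono (f≤g ∘ suc))

-- Each total is completed by the other function's value at `x`, so the two sides compare the sums
-- over `y ≢ x` without deleting a term.
∑-mono-off : ∀ {n} {f g : Fin n → ℕ} x → (∀ y → y ≢ x → f y ≤ g y) →
             sum f + g x ≤ f x + sum g
∑-mono-off {suc n} {f} {g} zero f≤g = ≤-by-certificate 0 (∑-mono (λ i → f≤g (suc i) λ ()))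
  (arrange (f zero) (sum (f ∘ suc)) (g zero) (sum (g ∘ suc)))
  where
  arrange : ∀ f₀ f g₀ g → f₀ + f + g₀ + g + 0 ≡ f₀ + (g₀ + g) + f
  arrange = solve-∀
∑-mono-off {suc n} {f} {g} (suc x) f≤g =
  ≤-by-certificate 0 (+-mono-≤ (f≤g zero λ ()) (∑-mono-off x λ y y≢x → f≤g (suc y) (y≢x ∘ Fin.suc-injective)))
    (arrange (f zero) (sum (f ∘ suc)) (g zero) (sum (g ∘ suc)) (f (suc x)) (g (suc x)))
  where
  arrange : ∀ f₀ f g₀ g fx gx →
    f₀ + f + gx + (g₀ + (fx + g)) + 0 ≡ fx + (g₀ + g) + (f₀ + (f + gx))
  arrange = solve-∀

∑-off : ∀ {n} {f g : Fin n → ℕ} x → (∀ y → y ≢ x → f y ≡ g y) →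
        sum f + g x ≡ f x + sum g
∑-off {f = f} {g} x f≡g = ≤-antisym (∑-mono-off x λ y y≢x → ≤-reflexive (f≡g y y≢x)) (begin
  f x + sum g  ≡⟨ +-comm (f x) (sum g) ⟩
  sum g + f x  ≤⟨ ∑-mono-off x (λ y y≢x → ≤-reflexive (sym (f≡g y y≢x))) ⟩
  g x + sum f  ≡⟨ +-comm (g x) (sum f) ⟩
  sum f + g x  ∎)
  where open ≤-Reasoning

∑-concentrated : ∀ {n} {f : Fin n → ℕ} x → (∀ y → y ≢ x → f y ≡ 0) → sum f ≡ f x
∑-concentrated {n} {f} x f≡0 = begin
  sum f                       ≡⟨ +-identityʳ (sum f) ⟨
  sum f + 0                   ≡⟨ ∑-off x f≡0 ⟩
  f x + sum {n} (λ _ → 0)     ≡⟨ cong (λ n → f x + n) (sum-replicate-zero n) ⟩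
  f x + 0                     ≡⟨ +-identityʳ (f x) ⟩
  f x                         ∎
  where open ≡-Reasoning

∑-const : ∀ n c → sum {n} (λ _ → c) ≡ n * c
∑-const zero    c = refl
∑-const (suc n) c = cong (λ n → c + n) (∑-const n c)

term≤∑ : ∀ {n} (f : Fin n → ℕ) x → f x ≤ sum f
term≤∑ f zero    = m≤m+n (f zero) _
term≤∑ f (suc x) = ≤-trans (term≤∑ (f ∘ suc) x) (m≤n+m _ (f zero))

-- A strict inequality at one index would already make `sum f` smaller than `sum g`.
∑-mono-tight : ∀ {n} {f g : Fin n → ℕ} → (∀ i → f i ≤ g i) → sum g ≤ sum f →
               ∀ x → g x ≤ f x
∑-mono-tight {f = f} {g} f≤g ∑g≤∑f x = +-cancelʳ-≤ (sum g) (g x) (f x) (begin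
  g x + sum g  ≤⟨ +-monoʳ-≤ (g x) ∑g≤∑f ⟩
  g x + sum f  ≡⟨ +-comm (g x) (sum f) ⟩
  sum f + g x  ≤⟨ ∑-mono-off x (λ y _ → f≤g y) ⟩
  f x + sum g  ∎)
  where open ≤-Reasoning

∑-positive : ∀ {n} (f : Fin n → ℕ) → 1 ≤ sum f → ∃ λ i → 1 ≤ f i
∑-positive {suc n} f 1≤∑ with f zero in eq
... | suc _ = zero , subst (1 ≤_) (sym eq) (s≤s z≤n)
... | zero  with i , 1≤fi ← ∑-positive (f ∘ suc) 1≤∑ = suc i , 1≤fi

χ : ∀ {n} → Subset n → Fin n → ℕ
χ p x = if lookup p x then 1 else 0

χ∈ : ∀ {n} {p : Subset n} {x} → x ∈ p → χ p x ≡ 1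
χ∈ x∈p rewrite []=⇒lookup x∈p = refl

χ∉ : ∀ {n} {p : Subset n} {x} → x ∉ p → χ p x ≡ 0
χ∉ {p = p} {x} x∉p with lookup p x in eq
... | true  = contradiction (lookup⇒[]= x p eq) x∉p
... | false = refl

χ≤1 : ∀ {n} (p : Subset n) x → χ p x ≤ 1
χ≤1 p x with lookup p x
... | true  = ≤-refl
... | false = z≤n

χ⇒∈ : ∀ {n} {p : Subset n} {x} → 1 ≤ χ p x → x ∈ p
χ⇒∈ {p = p} {x} h with lookup p x in eq | h
... | true | _ = lookup⇒[]= x p eq

∑χ : ∀ {n} (p : Subset n) → sum (χ p) ≡ ∣ p ∣
∑χ []            = refl
∑χ (true ∷ p)  = cong suc (∑χ p)
∑χ (false ∷ p) = ∑χ p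

-- Double counting in designs

idem-≤1 : ∀ {a} → a ≤ 1 → a * a ≡ a
idem-≤1 z≤n       = refl
idem-≤1 (s≤s z≤n) = refl

module DesignCounting {v k : ℕ} (D : Design v k) where
  open Design D

  e : Fin b → Fin v → ℕ
  e i = χ (block i)

  e²≡e : ∀ i x → e i x * e i x ≡ e i x
  e²≡e i x = idem-≤1 (χ≤1 (block i) x)

  ∑e : ∀ i → sum (e i) ≡ k
  ∑e i = trans (∑χ (block i)) (block-size i)

  weigh : (Fin b → ℕ) → Fin v → ℕ
  weigh f x = ∑[ i < b ] (f i * e i x)

  -- Incident pairs weighted by `c x * f i` are summed in two orders. Block sizes, intersections of
  -- blocks and squared traces all enter through this exchange.
  ∑-weighted : ∀ (f : Fin b → ℕ) (c : Fin v → ℕ) →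
    ∑[ x < v ] (c x * weigh f x) ≡ ∑[ i < b ] (f i * ∑[ x < v ] (c x * e i x))
  ∑-weighted f c = begin
    ∑[ x < v ] (c x * ∑[ i < b ] (f i * e i x))
      ≡⟨ sum-cong-≗ (λ x → *-distribˡ-sum (c x) (λ i → f i * e i x)) ⟩
    ∑[ x < v ] ∑[ i < b ] (c x * (f i * e i x))
      ≡⟨ ∑-comm (λ x i → c x * (f i * e i x)) ⟩
    ∑[ i < b ] ∑[ x < v ] (c x * (f i * e i x))
      ≡⟨ sum-cong-≗ (λ i → sum-cong-≗ λ x → swap (c x) (f i) (e i x)) ⟩
    ∑[ i < b ] ∑[ x < v ] (f i * (c x * e i x))
      ≡⟨ sum-cong-≗ (λ i → *-distribˡ-sum (f i) (λ x → c x * e i x)) ⟨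
    ∑[ i < b ] (f i * ∑[ x < v ] (c x * e i x)) ∎
    where
    open ≡-Reasoning
    swap : ∀ a b c → a * (b * c) ≡ b * (a * c)
    swap = solve-∀

  ∑-weigh : ∀ f → sum (weigh f) ≡ sum f * k
  ∑-weigh f = begin
    sum (weigh f)                                ≡⟨ sum-cong-≗ (λ x → sym (*-identityˡ (weigh f x))) ⟩
    ∑[ x < v ] (1 * weigh f x)                   ≡⟨ ∑-weighted f (λ _ → 1) ⟩
    ∑[ i < b ] (f i * ∑[ x < v ] (1 * e i x))    ≡⟨ sum-cong-≗ (λ i → cong (f i *_) (trans (sum-cong-≗ λ x → *-identityˡ (e i x)) (∑e i))) ⟩
    ∑[ i < b ] (f i * k)                         ≡⟨ *-distribʳ-sum k f ⟨
    sum f * k                                    ∎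
    where open ≡-Reasoning

  degree : Fin v → ℕ
  degree x = ∑[ i < b ] e i x

  pair-degree : ∀ {x y} → x ≢ y → ∑[ i < b ] (e i x * e i y) ≡ 1
  pair-degree {x} {y} x≢y with j , (x∈j , y∈j) , unique ← joining-block x≢y =
    trans (∑-concentrated j off) (cong₂ _*_ (χ∈ x∈j) (χ∈ y∈j))
    where
    off : ∀ i → i ≢ j → e i x * e i y ≡ 0
    off i i≢j with x ∈? block i | y ∈? block i
    ... | yes x∈i | yes y∈i = contradiction (sym (unique (x∈i , y∈i))) i≢j
    ... | yes x∈i | no y∉i  rewrite χ∉ y∉i = *-zeroʳ (e i x)
    ... | no x∉i  | _       rewrite χ∉ x∉i = refl

  -- Each block through `x` contributes its `k` points; in this count a point `y ≢ x` occurs once,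
  -- and `x` itself `degree x` times.
  degree-equation : ∀ x → degree x * k + 1 ≡ degree x + v
  degree-equation x = begin
    degree x * k + 1                  ≡⟨ cong (_+ 1) (∑-weigh (λ i → e i x)) ⟨
    sum (weigh (λ i → e i x)) + 1     ≡⟨ ∑-off x (λ y y≢x → pair-degree (y≢x ∘ sym)) ⟩
    weigh (λ i → e i x) x + sum {v} (λ _ → 1)
      ≡⟨ cong₂ _+_ (sum-cong-≗ λ i → e²≡e i x) (trans (∑-const v 1) (*-identityʳ v)) ⟩
    degree x + v                      ∎
    where open ≡-Reasoning

  ∑-degree : ∑[ x < v ] degree x ≡ b * k
  ∑-degree = begin
    sum degree                         ≡⟨ sum-cong-≗ (λ x → sum-cong-≗ λ i → sym (*-identityˡ (e i x))) ⟩
    sum (weigh (λ _ → 1))              ≡⟨ ∑-weigh (λ _ → 1) ⟩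
    sum {b} (λ _ → 1) * k              ≡⟨ cong (_* k) (trans (∑-const b 1) (*-identityʳ b)) ⟩
    b * k                              ∎
    where open ≡-Reasoning

  module EKR {S : Subset b} (ekr : IsEKR S) where

    -- The EKR condition provides a common point; a second one would make the blocks equal, since
    -- two points have only one joining block.
    meet : ∀ {i j} → i ∈ S → j ∈ S → j ≢ i → ∑[ x < v ] (e i x * e j x) ≡ 1
    meet {i} {j} i∈S j∈S j≢i
      with y , y∈i∩j ← ekr i∈S j∈S
      with y∈i , y∈j ← x∈p∩q⁻ (block i) (block j) y∈i∩j =
      trans (∑-concentrated y off) (cong₂ _*_ (χ∈ y∈i) (χ∈ y∈j))
      where
      off : ∀ x → x ≢ y → e i x * e j x ≡ 0
      off x x≢y with x ∈? block i | x ∈? block j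
      ... | yes x∈i | yes x∈j with _ , _ , unique ← joining-block x≢y =
        contradiction (trans (sym (unique (x∈j , y∈j))) (unique (x∈i , y∈i))) j≢i
      ... | yes x∈i | no x∉j  rewrite χ∉ x∉j = *-zeroʳ (e i x)
      ... | no x∉i  | _       rewrite χ∉ x∉i = refl

    -- Every block `j ≢ i` of `S` meets `block i` in one point and contributes `f j` once, while `i`
    -- contributes `k` times. The extra `f i` completes the sum over `j ≢ i` to `sum f`.
    ∑-weigh-block : ∀ {f} → (∀ j → j ∉ S → f j ≡ 0) → ∀ {i} → i ∈ S →
      ∑[ x < v ] (e i x * weigh f x) + f i ≡ f i * k + sum f
    ∑-weigh-block {f} f∉ {i} i∈S = begin
      ∑[ x < v ] (e i x * weigh f x) + f i
        ≡⟨ cong (_+ f i) (∑-weighted f (e i)) ⟩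
      ∑[ j < b ] (f j * ∑[ x < v ] (e i x * e j x)) + f i
        ≡⟨ ∑-off i off ⟩
      f i * ∑[ x < v ] (e i x * e i x) + sum f
        ≡⟨ cong (λ n → f i * n + sum f) (trans (sum-cong-≗ (e²≡e i)) (∑e i)) ⟩
      f i * k + sum f ∎
      where
      open ≡-Reasoning
      off : ∀ j → j ≢ i → f j * ∑[ x < v ] (e i x * e j x) ≡ f j
      off j j≢i with j ∈? S
      ... | yes j∈S = trans (cong (f j *_) (meet i∈S j∈S j≢i)) (*-identityʳ (f j))
      ... | no  j∉S rewrite f∉ j j∉S = refl

  trace : (Fin v → ℕ) → Fin b → ℕ
  trace c i = ∑[ x < v ] (c x * e i x)

  ∑-trace : ∀ c → sum (trace c) ≡ ∑[ x < v ] (c x * degree x)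
  ∑-trace c = trans (∑-comm (λ i x → c x * e i x))
    (sum-cong-≗ λ x → sym (*-distribˡ-sum (c x) (λ i → e i x)))

  weigh-trace : ∀ c x → weigh (trace c) x + c x ≡ c x * degree x + sum c
  weigh-trace c x = begin
    ∑[ i < b ] (trace c i * e i x) + c x
      ≡⟨ cong (_+ c x) (sum-cong-≗ λ i → *-distribʳ-sum (e i x) (λ y → c y * e i y)) ⟩
    ∑[ i < b ] ∑[ y < v ] (c y * e i y * e i x) + c x
      ≡⟨ cong (_+ c x) (∑-comm (λ i y → c y * e i y * e i x)) ⟩
    ∑[ y < v ] ∑[ i < b ] (c y * e i y * e i x) + c x
      ≡⟨ cong (_+ c x) (sum-cong-≗ λ y → trans (sum-cong-≗ λ i → *-assoc (c y) (e i y) (e i x))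
                                                (sym (*-distribˡ-sum (c y) (λ i → e i y * e i x)))) ⟩
    ∑[ y < v ] (c y * ∑[ i < b ] (e i y * e i x)) + c x
      ≡⟨ ∑-off x (λ y y≢x → trans (cong (c y *_) (pair-degree y≢x)) (*-identityʳ (c y))) ⟩
    c x * ∑[ i < b ] (e i x * e i x) + sum c
      ≡⟨ cong (λ d → c x * d + sum c) (sum-cong-≗ λ i → e²≡e i x) ⟩
    c x * degree x + sum c ∎
    where open ≡-Reasoning

  -- A squared trace counts ordered pairs of points on a block. Over all blocks a pair of distinct
  -- points occurs once and a pair (x, x) occurs `degree x` times.
  ∑-trace² : ∀ c → ∑[ i < b ] (trace c i * trace c i) + ∑[ x < v ] (c x * c x) ≡
             ∑[ x < v ] (c x * c x * degree x) + sum c * sum c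
  ∑-trace² c = begin
    ∑[ i < b ] (trace c i * trace c i) + ∑[ x < v ] (c x * c x)
      ≡⟨ cong (_+ sum (λ x → c x * c x)) (sym (∑-weighted (trace c) c)) ⟩
    ∑[ x < v ] (c x * weigh (trace c) x) + ∑[ x < v ] (c x * c x)
      ≡⟨ ∑-distrib-+ (λ x → c x * weigh (trace c) x) (λ x → c x * c x) ⟨
    ∑[ x < v ] (c x * weigh (trace c) x + c x * c x)
      ≡⟨ sum-cong-≗ (λ x → trans (sym (*-distribˡ-+ (c x) (weigh (trace c) x) (c x)))
           (trans (cong (c x *_) (weigh-trace c x)) (expand (c x) (degree x) (sum c)))) ⟩
    ∑[ x < v ] (c x * c x * degree x + c x * sum c)
      ≡⟨ ∑-distrib-+ (λ x → c x * c x * degree x) (λ x → c x * sum c) ⟩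
    ∑[ x < v ] (c x * c x * degree x) + ∑[ x < v ] (c x * sum c)
      ≡⟨ cong (λ n → sum (λ x → c x * c x * degree x) + n) (*-distribʳ-sum (sum c) c) ⟨
    ∑[ x < v ] (c x * c x * degree x) + sum c * sum c ∎
    where
    open ≡-Reasoning
    expand : ∀ a d w → a * (a * d + w) ≡ a * a * d + a * w
    expand = solve-∀

-- Parameters of a unital and the covering bound

3t≤t²+2 : ∀ t → 3 * t ≤ t * t + 2
3t≤t²+2 zero          = z≤n
3t≤t²+2 (suc zero)    = ≤-refl
3t≤t²+2 (suc (suc t)) =
  ≤-trans (m≤m+n (3 * (2 + t)) (t * t + t)) (≤-reflexive (identity t))
  where
  identity : ∀ t → 3 * (2 + t) + (t * t + t) ≡ (2 + t) * (2 + t) + 2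
  identity = solve-∀

module UnitalCounting {p : ℕ} (U : Unital (suc p)) where
  open Unital U
  open DesignCounting design public

  q v : ℕ
  q = suc p
  v = q ^ 3 + 1

  degree≡q² : ∀ x → degree x ≡ q * q
  degree≡q² x = *-cancelʳ-≡ (degree x) (q * q) q (+-cancelʳ-≡ (degree x + 1) _ _ (begin
    degree x * q + (degree x + 1)  ≡⟨ left (degree x) q ⟩
    degree x * (q + 1) + 1         ≡⟨ degree-equation x ⟩
    degree x + (q ^ 3 + 1)         ≡⟨ right (degree x) q ⟩
    q * q * q + (degree x + 1)     ∎))
    where
    open ≡-Reasoning
    left : ∀ d q → d * q + (d + 1) ≡ d * (q + 1) + 1
    left = solve-∀
    right : ∀ d q → d + (q * (q * (q * 1)) + 1) ≡ q * q * q + (d + 1)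
    right = solve-∀

  -- This is b = q⁴ - q³ + q², obtained from b (q + 1) = (q³ + 1) q² by cancelling q + 1.
  block-count : b + q * q * q ≡ q * q * q * q + q * q
  block-count = *-cancelʳ-≡ _ _ (q + 1) (begin
    (b + q * q * q) * (q + 1)            ≡⟨ *-distribʳ-+ (q + 1) b (q * q * q) ⟩
    b * (q + 1) + q * q * q * (q + 1)    ≡⟨ cong (_+ q * q * q * (q + 1)) ∑-degree ⟨
    sum degree + q * q * q * (q + 1)     ≡⟨ cong (_+ q * q * q * (q + 1)) (trans (sum-cong-≗ degree≡q²) (∑-const v (q * q))) ⟩
    v * (q * q) + q * q * q * (q + 1)    ≡⟨ expand q ⟩
    (q * q * q * q + q * q) * (q + 1)    ∎)
    where
    open ≡-Reasoning
    expand : ∀ q → (q * (q * (q * 1)) + 1) * (q * q) + q * q * q * (q + 1) ≡ (q * q * q * q + q * q) * (q + 1)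
    expand = solve-∀

  -- Here `c` is the indicator of X. Measuring |S| from q (q - 1) and |X| from q² centres the summed
  -- inequality: the square of q (q - 1) cancels and only u² - u is left on the right.
  cover-bound : ∀ (S : Subset b) (c : Fin v → ℕ) → (∀ x → c x ≤ 1) →
    (∀ {i x} → i ∈ S → x ∈ block i → c x ≡ 1) →
    ∀ {x u} → ∣ S ∣ ≡ q * p + x → sum c ≡ q * q + u → x * (q * p) + u ≤ u * u
  cover-bound S c c≤1 covers {x} {u} ∣S∣≡ w≡ = ≤-by-certificate 0 scaled (identity p x u)
    where
    w T² : ℕ
    w  = q * q + u
    T² = ∑[ i < b ] (trace c i * trace c i)

    identity : ∀ p x u →
      let q = suc p ; w = q * q + u in
      x * (q * p) + u + (q * q * w + w * w + 2 * (q * q * q * q + q * q)) + 0 ≡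
      u * u + ((q * p + x) * (q * p) + 3 * (q * q * w) + (w + 2 * (q * q * q)))
    identity = solve-∀

    c²≡c : ∀ x → c x * c x ≡ c x
    c²≡c x = idem-≤1 (c≤1 x)

    weighted-degrees : (f : Fin v → ℕ) → ∑[ x < v ] (f x * degree x) ≡ q * q * sum f
    weighted-degrees f = begin
      ∑[ x < v ] (f x * degree x)  ≡⟨ sum-cong-≗ (λ x → trans (cong (f x *_) (degree≡q² x)) (*-comm (f x) (q * q))) ⟩
      ∑[ x < v ] (q * q * f x)     ≡⟨ *-distribˡ-sum (q * q) f ⟨
      q * q * sum f                ∎
      where open ≡-Reasoning

    ∑T : sum (trace c) ≡ q * q * w
    ∑T = trans (∑-trace c) (trans (weighted-degrees c) (cong (q * q *_) w≡))

    ∑T² : T² + w ≡ q * q * w + w * w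
    ∑T² = begin
      T² + w                             ≡⟨ cong (λ n → T² + n) (trans (sum-cong-≗ c²≡c) w≡) ⟨
      T² + ∑[ x < v ] (c x * c x)        ≡⟨ ∑-trace² c ⟩
      ∑[ x < v ] (c x * c x * degree x) + sum c * sum c
        ≡⟨ cong₂ _+_ (trans (weighted-degrees λ x → c x * c x) (cong (q * q *_) (trans (sum-cong-≗ c²≡c) w≡)))
                     (cong₂ _*_ w≡ w≡) ⟩
      q * q * w + w * w                  ∎
      where open ≡-Reasoning

    -- At a block of `S` the trace is q + 1, where (t - 1)(t - 2) equals q (q - 1).
    pointwise : ∀ i → χ S i * (q * p) + 3 * trace c i ≤ trace c i * trace c i + 2
    pointwise i with i ∈? S
    ... | no i∉S rewrite χ∉ i∉S = 3t≤t²+2 (trace c i)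
    ... | yes i∈S = ≤-reflexive (begin
      χ S i * (q * p) + 3 * trace c i   ≡⟨ cong₂ (λ a t → a * (q * p) + 3 * t) (χ∈ i∈S) full ⟩
      1 * (q * p) + 3 * (q + 1)         ≡⟨ full-block p ⟩
      (q + 1) * (q + 1) + 2             ≡⟨ cong (λ t → t * t + 2) full ⟨
      trace c i * trace c i + 2         ∎)
      where
      open ≡-Reasoning
      full-block : ∀ p → 1 * (suc p * p) + 3 * (suc p + 1) ≡ (suc p + 1) * (suc p + 1) + 2
      full-block = solve-∀
      on-block : ∀ y → c y * e i y ≡ e i y
      on-block y with y ∈? block i
      ... | yes y∈i = trans (cong (_* e i y) (covers i∈S y∈i)) (*-identityˡ (e i y))
      ... | no  y∉i rewrite χ∉ y∉i = *-zeroʳ (c y)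
      full : trace c i ≡ q + 1
      full = trans (sum-cong-≗ on-block) (∑e i)

    total : ∣ S ∣ * (q * p) + 3 * sum (trace c) ≤ T² + b * 2
    total = begin
      ∣ S ∣ * (q * p) + 3 * sum (trace c)
        ≡⟨ cong₂ _+_ (trans (cong (_* (q * p)) (sym (∑χ S))) (*-distribʳ-sum (q * p) (χ S)))
                     (*-distribˡ-sum 3 (trace c)) ⟩
      ∑[ i < b ] (χ S i * (q * p)) + ∑[ i < b ] (3 * trace c i)
        ≡⟨ ∑-distrib-+ (λ i → χ S i * (q * p)) (λ i → 3 * trace c i) ⟨
      ∑[ i < b ] (χ S i * (q * p) + 3 * trace c i)
        ≤⟨ ∑-mono pointwise ⟩
      ∑[ i < b ] (trace c i * trace c i + 2)
        ≡⟨ ∑-distrib-+ (λ i → trace c i * trace c i) (λ _ → 2) ⟩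
      T² + sum {b} (λ _ → 2)
        ≡⟨ cong (λ n → T² + n) (∑-const b 2) ⟩
      T² + b * 2 ∎
      where open ≤-Reasoning

    -- Adding `w` and 2 q³ turns `T²` and `b * 2` into the sums evaluated by `∑T²` and
    -- `block-count`.
    scaled : (q * p + x) * (q * p) + 3 * (q * q * w) + (w + 2 * (q * q * q)) ≤
             q * q * w + w * w + 2 * (q * q * q * q + q * q)
    scaled = begin
      (q * p + x) * (q * p) + 3 * (q * q * w) + (w + 2 * (q * q * q))
        ≡⟨ cong₂ (λ n t → n * (q * p) + 3 * t + (w + 2 * (q * q * q))) ∣S∣≡ ∑T ⟨
      ∣ S ∣ * (q * p) + 3 * sum (trace c) + (w + 2 * (q * q * q))
        ≤⟨ +-monoˡ-≤ (w + 2 * (q * q * q)) total ⟩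
      T² + b * 2 + (w + 2 * (q * q * q))
        ≡⟨ rearrange T² b w (q * q * q) ⟩
      T² + w + 2 * (b + q * q * q)
        ≡⟨ cong₂ (λ s t → s + 2 * t) ∑T² block-count ⟩
      q * q * w + w * w + 2 * (q * q * q * q + q * q) ∎
      where
      open ≤-Reasoning
      rearrange : ∀ a b w c → a + b * 2 + (w + 2 * c) ≡ a + w + 2 * (b + c)
      rearrange = solve-∀

-- Erdős–Ko–Rado sets in unitals

module PointPencils {p : ℕ} (U : Unital (suc p)) {S : Subset (Unital.b U)} (maximal : Unital.IsMaximalEKR U S) where
  open Unital U
  open UnitalCounting U

  pencil-or-avoidable :
    (∃ λ P → ∀ i → i ∈ S → P ∈ block i) ⊎ (∀ P → ∃ λ i → i ∈ S × P ∉ block i)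
  pencil-or-avoidable
    with Fin.any? (λ P → Fin.all? (λ i → (i ∈? S) →-dec (P ∈? block i)))
  ... | yes common = inj₁ common
  ... | no ¬common = inj₂ λ P →
    let i , ¬[i∈S→P∈i] = Fin.¬∀⟶∃¬ b _ (λ i → (i ∈? S) →-dec (P ∈? block i)) (λ all → ¬common (P , all))
    in i , decidable-stable (i ∈? S) (λ i∉S → ¬[i∈S→P∈i] λ i∈S → contradiction i∈S i∉S)
         , λ P∈i → ¬[i∈S→P∈i] λ _ → P∈i

  -- All blocks through `P` form an EKR set containing `S`, so maximality makes the two equal, and
  -- the size is the degree of `P`.
  pencil : ∀ {P} → (∀ i → i ∈ S → P ∈ block i) → ∣ S ∣ ≡ q ^ 2 × IsPointPencil S
  pencil {P} common = size , P , iff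
    where
    T : Subset b
    T = tabulate λ i → lookup (block i) P

    ∈T⇒ : ∀ {i} → i ∈ T → P ∈ block i
    ∈T⇒ {i} i∈T = lookup⇒[]= P (block i)
      (trans (sym (lookup∘tabulate _ i)) ([]=⇒lookup i∈T))

    ⇒∈T : ∀ {i} → P ∈ block i → i ∈ T
    ⇒∈T {i} P∈i = lookup⇒[]= i T (trans (lookup∘tabulate _ i) ([]=⇒lookup P∈i))

    T-ekr : IsEKR T
    T-ekr i∈T j∈T = P , x∈p∩q⁺ (∈T⇒ i∈T , ∈T⇒ j∈T)

    through⇒∈S : ∀ i → P ∈ block i → i ∈ S
    through⇒∈S i P∈i = decidable-stable (i ∈? S) λ i∉S →
      proj₂ maximal (T , T-ekr , (λ {j} j∈S → ⇒∈T (common j j∈S)) , i , ⇒∈T P∈i , i∉S)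

    iff : ∀ i → i ∈ S ⇔ P ∈ block i
    iff i = mk⇔ (common i) (through⇒∈S i)

    same : ∀ i → χ S i ≡ e i P
    same i with i ∈? S
    ... | yes i∈S = trans (χ∈ i∈S) (sym (χ∈ (common i i∈S)))
    ... | no  i∉S = trans (χ∉ i∉S) (sym (χ∉ λ P∈i → i∉S (through⇒∈S i P∈i)))

    size : ∣ S ∣ ≡ q ^ 2
    size = begin
      ∣ S ∣      ≡⟨ ∑χ S ⟨
      sum (χ S)  ≡⟨ sum-cong-≗ same ⟩
      degree P   ≡⟨ degree≡q² P ⟩
      q * q      ≡⟨ cong (q *_) (*-identityʳ q) ⟨
      q ^ 2      ∎
      where open ≡-Reasoning

-- The first alternative arises from a point on q + 1 blocks of `S`, with u = q + 1. In the second
-- no such point exists and X is the union of `S`; `suc u` records that |X| exceeds q².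
SizeBound : ℕ → ℕ → Set
SizeBound p N = let q = suc p in ∀ x → 1 ≤ x → N ≡ q * p + x →
  (x * (q * p) + (q + 1) ≤ (q + 1) * (q + 1)) ⊎
  (x ≤ q × ∃ λ u →
    suc u * x + q * x ≤ q * p + x + x * x × x * (q * p) + suc u ≤ suc u * suc u)

module NoCommonPoint {p : ℕ} (U : Unital (suc p)) {S : Subset (Unital.b U)}
  (ekr : Unital.IsEKR U S)
  (avoid : ∀ P → ∃ λ i → i ∈ S × P ∉ Unital.block U i) where
  open Unital U
  open UnitalCounting U
  open EKR ekr

  s : Fin v → ℕ
  s = weigh (χ S)

  through : Fin v → Fin b → ℕ
  through P i = χ S i * e i P

  joined : Fin v → Fin v → ℕ
  joined P = weigh (through P)

  joined≤1 : ∀ {P x} → x ≢ P → joined P x ≤ 1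
  joined≤1 {P} {x} x≢P = begin
    ∑[ i < b ] (χ S i * e i P * e i x)  ≤⟨ ∑-mono (λ i → *-monoˡ-≤ (e i x) (≤-trans (*-monoˡ-≤ (e i P) (χ≤1 S i)) (≤-reflexive (*-identityˡ (e i P))))) ⟩
    ∑[ i < b ] (e i P * e i x)          ≡⟨ pair-degree (x≢P ∘ sym) ⟩
    1                                   ∎
    where open ≤-Reasoning

  joined-self : ∀ P → joined P P ≡ s P
  joined-self P = sum-cong-≗ λ i → trans (*-assoc (χ S i) (e i P) (e i P)) (cong (χ S i *_) (e²≡e i P))

  -- Each of the `s P` blocks of `S` through `P` meets `block i` in exactly one point, and `i`
  -- itself has weight 0 because it misses `P`.
  ∑-joined-block : ∀ {P i} → i ∈ S → P ∉ block i → ∑[ x < v ] (e i x * joined P x) ≡ s P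
  ∑-joined-block {P} {i} i∈S P∉i = begin
    ∑[ x < v ] (e i x * joined P x)                ≡⟨ +-identityʳ _ ⟨
    ∑[ x < v ] (e i x * joined P x) + 0            ≡⟨ cong (λ n → sum (λ x → e i x * joined P x) + n) through≡0 ⟨
    ∑[ x < v ] (e i x * joined P x) + through P i  ≡⟨ ∑-weigh-block (λ j j∉S → cong (_* e j P) (χ∉ j∉S)) i∈S ⟩
    through P i * (q + 1) + s P                    ≡⟨ cong (λ n → n * (q + 1) + s P) through≡0 ⟩
    s P                                            ∎
    where
    open ≡-Reasoning
    through≡0 : through P i ≡ 0
    through≡0 = trans (cong (χ S i *_) (χ∉ P∉i)) (*-zeroʳ (χ S i))

  joined-on-block : ∀ {P i} → P ∉ block i → ∀ x → e i x * joined P x ≤ e i x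
  joined-on-block {P} {i} P∉i x with x ∈? block i
  ... | no x∉i rewrite χ∉ x∉i = z≤n
  ... | yes x∈i = ≤-trans (*-monoʳ-≤ (e i x) (joined≤1 λ { refl → P∉i x∈i }))
                          (≤-reflexive (*-identityʳ (e i x)))

  -- Some block of `S` misses `P`, and the blocks of `S` through `P` meet it in distinct points.
  s≤q+1 : ∀ P → s P ≤ q + 1
  s≤q+1 P with i , i∈S , P∉i ← avoid P = begin
    s P                              ≡⟨ ∑-joined-block i∈S P∉i ⟨
    ∑[ x < v ] (e i x * joined P x)  ≤⟨ ∑-mono (joined-on-block P∉i) ⟩
    sum (e i)                        ≡⟨ ∑e i ⟩
    q + 1                            ∎
    where open ≤-Reasoning

  -- The q + 1 blocks of `S` through `P` share only `P`, so their union has (q + 1) q + 1 points. A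
  -- block of `S` off `P` has just q + 1 points to meet them in, so all of its points lie in the
  -- union.
  full-point-bound : ∀ {P x} → s P ≡ q + 1 → ∣ S ∣ ≡ q * p + x →
    x * (q * p) + (q + 1) ≤ (q + 1) * (q + 1)
  full-point-bound {P} s≡q+1 ∣S∣≡ =
    cover-bound S c (λ x → m⊓n≤n (joined P x) 1) covers ∣S∣≡ size
    where
    c : Fin v → ℕ
    -- The truncation changes the value only at `P`, where `joined P P` is q + 1.
    c x = joined P x ⊓ 1

    1≤joined⇒ : ∀ {x} → 1 ≤ joined P x → c x ≡ 1
    1≤joined⇒ = m≥n⇒m⊓n≡n

    covers : ∀ {i x} → i ∈ S → x ∈ block i → c x ≡ 1
    covers {i} {x} i∈S x∈i with P ∈? block i
    ... | yes P∈i = 1≤joined⇒ (≤-trans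
      (≤-reflexive (sym (cong₂ _*_ (cong₂ _*_ (χ∈ i∈S) (χ∈ P∈i)) (χ∈ x∈i))))
      (term≤∑ (λ j → through P j * e j x) i))
    ... | no P∉i = 1≤joined⇒ (begin
      1                   ≡⟨ χ∈ x∈i ⟨
      e i x               ≤⟨ ∑-mono-tight (joined-on-block P∉i) (≤-reflexive tight) x ⟩
      e i x * joined P x  ≡⟨ cong (_* joined P x) (χ∈ x∈i) ⟩
      1 * joined P x      ≡⟨ *-identityˡ (joined P x) ⟩
      joined P x          ∎)
      where
      open ≤-Reasoning
      tight : sum (e i) ≡ ∑[ x < v ] (e i x * joined P x)
      tight = trans (∑e i) (sym (trans (∑-joined-block i∈S P∉i) s≡q+1))

    size : sum c ≡ q * q + (q + 1)
    size = +-cancelˡ-≡ (q + 1) _ _ (begin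
      q + 1 + sum c                 ≡⟨ cong (_+ sum c) (trans (joined-self P) s≡q+1) ⟨
      joined P P + sum c            ≡⟨ ∑-off P (λ x x≢P → sym (m≤n⇒m⊓n≡m (joined≤1 x≢P))) ⟨
      sum (joined P) + c P          ≡⟨ cong₂ _+_ (trans (∑-weigh (through P)) (cong (_* (q + 1)) s≡q+1)) (1≤joined⇒ 1≤joinedPP) ⟩
      (q + 1) * (q + 1) + 1         ≡⟨ expand q ⟩
      q + 1 + (q * q + (q + 1))     ∎)
      where
      open ≡-Reasoning
      1≤joinedPP : 1 ≤ joined P P
      1≤joinedPP = subst (1 ≤_) (sym (trans (joined-self P) s≡q+1)) (m≤n+m 1 q)
      expand : ∀ q → (q + 1) * (q + 1) + 1 ≡ q + 1 + (q * q + (q + 1))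
      expand = solve-∀

  module _ (s≤q : ∀ P → s P ≤ q) {x : ℕ} (1≤x : 1 ≤ x) (∣S∣≡ : ∣ S ∣ ≡ q * p + x) where

    N : ℕ
    N = q * p + x

    ∑χS : sum (χ S) ≡ N
    ∑χS = trans (∑χ S) ∣S∣≡

    -- The block is counted q + 1 times and the other N - 1 blocks of `S` once each.
    ∑-s-block : ∀ {i} → i ∈ S → ∑[ y < v ] (e i y * s y) ≡ q * q + x
    ∑-s-block {i} i∈S = +-cancelʳ-≡ 1 _ _ (begin
      ∑[ y < v ] (e i y * s y) + 1         ≡⟨ cong (λ n → sum (λ y → e i y * s y) + n) (χ∈ i∈S) ⟨
      ∑[ y < v ] (e i y * s y) + χ S i     ≡⟨ ∑-weigh-block (λ j → χ∉) i∈S ⟩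
      χ S i * (q + 1) + sum (χ S)          ≡⟨ cong₂ (λ a n → a * (q + 1) + n) (χ∈ i∈S) ∑χS ⟩
      1 * (q + 1) + N                      ≡⟨ expand p x ⟩
      q * q + x + 1                        ∎)
      where
      open ≡-Reasoning
      expand : ∀ p x → 1 * (suc p + 1) + (suc p * p + x) ≡ suc p * suc p + x + 1
      expand = solve-∀

    ∑-q-block : ∀ i → ∑[ y < v ] (e i y * q) ≡ (q + 1) * q
    ∑-q-block i = trans (sym (*-distribʳ-sum q (e i))) (cong (_* q) (∑e i))

    x≤q : x ≤ q
    x≤q with i , 1≤χi ← ∑-positive (χ S) (subst (1 ≤_) (sym ∑χS) (≤-trans 1≤x (m≤n+m x (q * p)))) =
      +-cancelˡ-≤ (q * q) x q (begin
        q * q + x                    ≡⟨ ∑-s-block (χ⇒∈ 1≤χi) ⟨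
        ∑[ y < v ] (e i y * s y)     ≤⟨ ∑-mono (λ y → *-monoʳ-≤ (e i y) (s≤q y)) ⟩
        ∑[ y < v ] (e i y * q)       ≡⟨ ∑-q-block i ⟩
        (q + 1) * q                  ≡⟨ expand q ⟩
        q * q + q                    ∎)
      where
      open ≤-Reasoning
      expand : ∀ q → (q + 1) * q ≡ q * q + q
      expand = solve-∀

    -- The other q points of the block carry at most q² of the total q² + x, so at least x falls on
    -- `P`.
    x≤s : ∀ {i P} → i ∈ S → P ∈ block i → x ≤ s P
    x≤s {i} {P} i∈S P∈i = ≤-by-certificate 0 (begin
      q * q + x + q                               ≡⟨ cong₂ _+_ (∑-s-block i∈S) (at-P q) ⟨
      ∑[ y < v ] (e i y * s y) + e i P * q        ≤⟨ ∑-mono-off P (λ y _ → *-monoʳ-≤ (e i y) (s≤q y)) ⟩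
      e i P * s P + ∑[ y < v ] (e i y * q)        ≡⟨ cong₂ _+_ (at-P (s P)) (∑-q-block i) ⟩
      s P + (q + 1) * q                           ∎) (expand q x (s P))
      where
      open ≤-Reasoning
      at-P : ∀ n → e i P * n ≡ n
      at-P n = trans (cong (_* n) (χ∈ P∈i)) (*-identityˡ n)
      expand : ∀ q x s → x + (s + (q + 1) * q) + 0 ≡ s + (q * q + x + q)
      expand = solve-∀

    -- The indicator of the union of the blocks of `S`.
    c : Fin v → ℕ
    c y = s y ⊓ 1

    w : ℕ
    w = sum c

    covers : ∀ {i y} → i ∈ S → y ∈ block i → c y ≡ 1
    covers i∈S y∈i = m≥n⇒m⊓n≡n (≤-trans 1≤x (x≤s i∈S y∈i))

    x≤s-or-uncovered : ∀ y → (s y ≡ 0) ⊎ (c y ≡ 1 × x ≤ s y)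
    x≤s-or-uncovered y with s y in eq
    ... | zero  = inj₁ refl
    ... | suc n
      with i , 1≤ ← ∑-positive (λ i → χ S i * e i y) (subst (1 ≤_) (sym eq) (s≤s z≤n))
      with i ∈? S | y ∈? block i
    ... | no i∉S | _ = contradiction (subst (λ a → 1 ≤ a * e i y) (χ∉ i∉S) 1≤) λ ()
    ... | yes _  | no y∉i =
      contradiction (subst (1 ≤_) (trans (cong (χ S i *_) (χ∉ y∉i)) (*-zeroʳ (χ S i))) 1≤) λ ()
    ... | yes i∈S | yes y∈i = inj₂ (m≥n⇒m⊓n≡n {suc n} (s≤s z≤n) , subst (x ≤_) eq (x≤s i∈S y∈i))

    ∑s : sum s ≡ N * (q + 1)
    ∑s = trans (∑-weigh (χ S)) (cong (_* (q + 1)) ∑χS)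

    ∑s≤wq : N * (q + 1) ≤ w * q
    ∑s≤wq = begin
      N * (q + 1)             ≡⟨ ∑s ⟨
      sum s                   ≤⟨ ∑-mono pointwise ⟩
      ∑[ y < v ] (c y * q)    ≡⟨ *-distribʳ-sum q c ⟨
      w * q                   ∎
      where
      open ≤-Reasoning
      pointwise : ∀ y → s y ≤ c y * q
      pointwise y with x≤s-or-uncovered y
      ... | inj₁ s≡0 = subst (_≤ c y * q) (sym s≡0) z≤n
      ... | inj₂ (c≡1 , _) = ≤-trans (s≤q y)
        (≤-reflexive (sym (trans (cong (_* q) c≡1) (*-identityˡ q))))

    q²<w : q * q < w
    q²<w = *-cancelʳ-< q (q * q) w (begin-strict
      q * q * q       <⟨ n<1+n (q * q * q) ⟩
      suc (q * q * q) ≤⟨ ≤-by-certificate 0 (*-monoˡ-≤ (q + 1) 1≤x) (expand p x) ⟩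
      N * (q + 1)     ≤⟨ ∑s≤wq ⟩
      w * q           ∎)
      where
      open ≤-Reasoning
      expand : ∀ p x → suc (suc p * suc p * suc p) + x * (suc p + 1) + 0 ≡
                       (suc p * p + x) * (suc p + 1) + 1 * (suc p + 1)
      expand = solve-∀

    -- One factor `s y` is expanded into the blocks of `S` through `y`; along each of them `s` has
    -- the same sum.
    ∑s² : ∑[ y < v ] (s y * s y) ≡ N * (q * q + x)
    ∑s² = begin
      ∑[ y < v ] (s y * s y)                             ≡⟨ ∑-weighted (χ S) s ⟩
      ∑[ i < b ] (χ S i * ∑[ y < v ] (s y * e i y))      ≡⟨ sum-cong-≗ pointwise ⟩
      ∑[ i < b ] (χ S i * (q * q + x))                   ≡⟨ *-distribʳ-sum (q * q + x) (χ S) ⟨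
      sum (χ S) * (q * q + x)                            ≡⟨ cong (_* (q * q + x)) ∑χS ⟩
      N * (q * q + x)                                    ∎
      where
      open ≡-Reasoning
      pointwise : ∀ i → χ S i * ∑[ y < v ] (s y * e i y) ≡ χ S i * (q * q + x)
      pointwise i with i ∈? S
      ... | no i∉S rewrite χ∉ i∉S = refl
      ... | yes i∈S = cong (χ S i *_) (trans (sum-cong-≗ λ y → *-comm (s y) (e i y)) (∑-s-block i∈S))

    -- Sum of (s - x)(q - s) ≥ 0 over the union, with Σs and Σs² known. The common factor q is
    -- cancelled.
    wx≤N[x+1] : w * x ≤ N * (x + 1)
    wx≤N[x+1] = *-cancelʳ-≤ (w * x) (N * (x + 1)) q (≤-by-certificate 0 summed (expand p x w))
      where
      expand : ∀ p x w → let q = suc p ; N = q * p + x in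
        w * x * q + (x + q) * (N * (q + 1)) + 0 ≡ N * (x + 1) * q + (N * (q * q + x) + w * (x * q))
      expand = solve-∀

      between : ∀ {x s q} → x ≤ s → s ≤ q → s * s + 1 * (x * q) ≤ (x + q) * s
      between {x} x≤s s≤q
        with a , refl ← m≤n⇒∃[o]m+o≡n x≤s with d , refl ← m≤n⇒∃[o]m+o≡n s≤q =
        ≤-trans (m≤m+n _ (a * d)) (≤-reflexive (identity x a d))
        where
        identity : ∀ x a d → (x + a) * (x + a) + 1 * (x * (x + a + d)) + a * d ≡ (x + (x + a + d)) * (x + a)
        identity = solve-∀

      -- The factor `c y` removes x q outside the union, where `s y` is 0 and (s - x)(q - s) would
      -- be negative.
      pointwise : ∀ y → s y * s y + c y * (x * q) ≤ (x + q) * s y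
      pointwise y with x≤s-or-uncovered y
      ... | inj₁ s≡0 rewrite s≡0 = z≤n
      ... | inj₂ (c≡1 , x≤sy) rewrite c≡1 = between x≤sy (s≤q y)

      open ≤-Reasoning
      summed : N * (q * q + x) + w * (x * q) ≤ (x + q) * (N * (q + 1))
      summed = begin
        N * (q * q + x) + w * (x * q)
          ≡⟨ cong₂ _+_ (sym ∑s²) (*-distribʳ-sum (x * q) c) ⟩
        ∑[ y < v ] (s y * s y) + ∑[ y < v ] (c y * (x * q))
          ≡⟨ ∑-distrib-+ (λ y → s y * s y) (λ y → c y * (x * q)) ⟨
        ∑[ y < v ] (s y * s y + c y * (x * q))
          ≤⟨ ∑-mono pointwise ⟩
        ∑[ y < v ] ((x + q) * s y)
          ≡⟨ *-distribˡ-sum (x + q) s ⟨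
        (x + q) * sum s
          ≡⟨ cong ((x + q) *_) ∑s ⟩
        (x + q) * (N * (q + 1)) ∎

    no-full-point-bound : ∃ λ u →
      suc u * x + q * x ≤ q * p + x + x * x × x * (q * p) + suc u ≤ suc u * suc u
    no-full-point-bound with u , q²+u≡w ← m≤n⇒∃[o]m+o≡n q²<w =
      u , ≤-by-certificate 0 (subst (λ w → w * x ≤ N * (x + 1)) w≡ wx≤N[x+1]) (expand p x u)
        , cover-bound S c (λ y → m⊓n≤n (s y) 1) covers ∣S∣≡ w≡
      where
      w≡ : w ≡ q * q + suc u
      w≡ = trans (sym q²+u≡w) (sym (+-suc (q * q) u))
      expand : ∀ p x u → let q = suc p in
        suc u * x + q * x + (q * p + x) * (x + 1) + 0 ≡ q * p + x + x * x + (q * q + suc u) * x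
      expand = solve-∀

  size-bound : SizeBound p ∣ S ∣
  size-bound x 1≤x ∣S∣≡ with Fin.any? (λ P → s P ≟ q + 1)
  ... | yes (P , s≡q+1) = inj₁ (full-point-bound s≡q+1 ∣S∣≡)
  ... | no  ¬full = inj₂ (x≤q s≤q 1≤x ∣S∣≡ , no-full-point-bound s≤q 1≤x ∣S∣≡)
    where
    s≤q : ∀ P → s P ≤ q
    s≤q P = ≤-pred (≤-trans (≤∧≢⇒< (s≤q+1 P) (λ s≡ → ¬full (P , s≡))) (≤-reflexive (+-comm q 1)))

-- Numerical consequences

-- E is (q - x)(p - x) with q = p + 1, which is 0 for x = q.
gap-product : ∀ {p x} → x ≤ suc p → ∃ λ E → E + (suc p + p) * x ≡ suc p * p + x * x
gap-product {p} {x} x≤q with m≤n⇒m<n∨m≡n x≤q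
... | inj₂ refl = 0 , identity p
  where
  identity : ∀ p → 0 + (suc p + p) * suc p ≡ suc p * p + suc p * suc p
  identity = solve-∀
... | inj₁ (s≤s x≤p) with z , refl ← m≤n⇒∃[o]m+o≡n x≤p = suc z * z , identity x z
  where
  identity : ∀ x z → suc z * z + (suc (x + z) + (x + z)) * x ≡ suc (x + z) * (x + z) + x * x
  identity = solve-∀

-- Multiplying the quadratic bound by x² lets the linear bound on u x be inserted. The product
-- becomes q p x² + E (q p + x²); then E ≤ q p and division by q p leave x³ ≤ 2 x² + E.
cubic-bound : ∀ {p x u} → 1 ≤ p → x ≤ suc p → let q = suc p in
  suc u * x + q * x ≤ q * p + x + x * x → x * (q * p) + suc u ≤ suc u * suc u →
  x * x * x + (q + p) * x ≤ 3 * (x * x) + q * p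
cubic-bound {p@(suc _)} {x} {u} _ x≤q linear quadratic with E , E≡ ← gap-product x≤q =
  ≤-by-certificate 0 (+-mono-≤ x³≤2x²+E (≤-reflexive E≡)) (regroup x E ((q + p) * x) (q * p))
  where
  q = suc p

  regroup : ∀ x E s t →
    x * x * x + s + (2 * (x * x) + E + (t + x * x)) + 0 ≡ 3 * (x * x) + t + (x * x * x + (E + s))
  regroup = solve-∀

  E≤qp : E ≤ q * p
  E≤qp = ≤-by-certificate 0 (+-mono-≤ (≤-reflexive E≡) (*-monoˡ-≤ x (≤-trans x≤q (m≤m+n q p))))
    (arrange E ((q + p) * x) (q * p) (x * x))
    where
    arrange : ∀ E s t r → E + (t + r + s) + 0 ≡ t + (E + s + r)
    arrange = solve-∀

  ux≤ : u * x ≤ p * x + E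
  ux≤ = ≤-by-certificate 0 (+-mono-≤ linear (≤-reflexive (sym E≡))) (arrange p x u E)
    where
    arrange : ∀ p x u E → let q = suc p in
      u * x + (q * p + x + x * x + (E + (q + p) * x)) + 0 ≡
      p * x + E + (suc u * x + q * x + (q * p + x * x))
    arrange = solve-∀

  product : x * (q * p) * (x * x) ≤ (p * x + E + x) * (p * x + E)
  product = begin
    x * (q * p) * (x * x)          ≤⟨ *-monoˡ-≤ (x * x) (≤-by-certificate {b = suc u * u} 0 quadratic (arrange₁ (x * (q * p)) u)) ⟩
    suc u * u * (x * x)            ≡⟨ arrange₂ x u ⟩
    (u * x + x) * (u * x)          ≤⟨ *-mono-≤ (+-monoˡ-≤ x ux≤) ux≤ ⟩
    (p * x + E + x) * (p * x + E)  ∎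
    where
    open ≤-Reasoning
    arrange₁ : ∀ a u → a + suc u * suc u + 0 ≡ suc u * u + (a + suc u)
    arrange₁ = solve-∀
    arrange₂ : ∀ x u → suc u * u * (x * x) ≡ (u * x + x) * (u * x)
    arrange₂ = solve-∀

  x³≤2x²+E : x * x * x ≤ 2 * (x * x) + E
  x³≤2x²+E = *-cancelˡ-≤ (q * p) (begin
    q * p * (x * x * x)                              ≡⟨ arrange₁ (q * p) x ⟩
    x * (q * p) * (x * x)                            ≤⟨ product ⟩
    (p * x + E + x) * (p * x + E)                    ≡⟨ arrange₂ p x E ⟩
    q * p * (x * x) + E * (E + (q + p) * x)          ≡⟨ cong (λ n → q * p * (x * x) + E * n) E≡ ⟩
    q * p * (x * x) + E * (q * p + x * x)            ≡⟨ arrange₃ (q * p) (x * x) E ⟩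
    q * p * (x * x) + q * p * E + E * (x * x)        ≤⟨ +-monoʳ-≤ (q * p * (x * x) + q * p * E) (*-monoˡ-≤ (x * x) E≤qp) ⟩
    q * p * (x * x) + q * p * E + q * p * (x * x)    ≡⟨ arrange₄ (q * p) (x * x) E ⟩
    q * p * (2 * (x * x) + E)                        ∎)
    where
    open ≤-Reasoning
    arrange₁ : ∀ a x → a * (x * x * x) ≡ x * a * (x * x)
    arrange₁ = solve-∀
    arrange₂ : ∀ p x E → (p * x + E + x) * (p * x + E) ≡ suc p * p * (x * x) + E * (E + (suc p + p) * x)
    arrange₂ = solve-∀
    arrange₃ : ∀ a x E → a * x + E * (a + x) ≡ a * x + a * E + E * x
    arrange₃ = solve-∀
    arrange₄ : ∀ a x E → a * x + a * E + a * x ≡ a * (2 * x + E)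
    arrange₄ = solve-∀

-- Integer estimates for scaled cube roots

cube : ∀ a → a ^ 3 ≡ a * a * a
cube a = trans (cong (λ b → a * (a * b)) (*-identityʳ a)) (sym (*-assoc a a a))

cube-cancel-≤ : ∀ {a b} → a * a * a ≤ b * b * b → a ≤ b
cube-cancel-≤ {a} {b} a³≤b³ = ≮⇒≥ λ b<a → <⇒≱ (^-monoˡ-< 3 b<a)
  (≤-trans (≤-reflexive (cube a)) (≤-trans a³≤b³ (≤-reflexive (sym (cube b)))))

cube-cancel-< : ∀ {a b} → a * a * a < b * b * b → a < b
cube-cancel-< {a} {b} a³<b³ = ≰⇒> λ b≤a →
  <⇒≱ a³<b³ (*-mono-≤ (*-mono-≤ b≤a b≤a) b≤a)

-- `A` and `B` are the integer parts of M ∛(q²) and M ∛q for q = 5 + l. The bound 5 q ≤ M keeps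
-- rounding errors small.
module ScaledRoots {l M A B : ℕ} (5q≤M : 5 * (5 + l) ≤ M)
  (A³≤ : A * A * A ≤ (5 + l) * (5 + l) * (M * M * M))
  (A³> : (5 + l) * (5 + l) * (M * M * M) < suc A * suc A * suc A)
  (B³≤ : B * B * B ≤ (5 + l) * (M * M * M))
  (B³> : (5 + l) * (M * M * M) < suc B * suc B * suc B) where

  q : ℕ
  q = 5 + l

  B≤A : B ≤ A
  B≤A = ≤-pred (cube-cancel-< (≤-<-trans (≤-trans B³≤ (*-monoˡ-≤ (M * M * M) (m≤m*n q q))) A³>))

  5A≤ : 5 * A ≤ (2 * q + 5) * M
  5A≤ = cube-cancel-≤ (begin
    5 * A * (5 * A) * (5 * A)                    ≡⟨ arrange A ⟩
    125 * (A * A * A)                            ≤⟨ *-monoʳ-≤ 125 A³≤ ⟩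
    125 * (q * q * (M * M * M))                  ≤⟨ m≤m+n _ _ ⟩
    125 * (q * q * (M * M * M)) + (250 + 100 * l + 55 * (l * l) + 8 * (l * l * l)) * (M * M * M)
                                                 ≡⟨ expand l M ⟩
    (2 * q + 5) * M * ((2 * q + 5) * M) * ((2 * q + 5) * M) ∎)
    where
    open ≤-Reasoning
    arrange : ∀ A → 5 * A * (5 * A) * (5 * A) ≡ 125 * (A * A * A)
    arrange = solve-∀
    expand : ∀ l M → let q = 5 + l in
      125 * (q * q * (M * M * M)) + (250 + 100 * l + 55 * (l * l) + 8 * (l * l * l)) * (M * M * M) ≡
      (2 * q + 5) * M * ((2 * q + 5) * M) * ((2 * q + 5) * M)
    expand = solve-∀

  -- This is ∛q > 3/2, since 27 < 8 q.
  3M<2[B+1] : 3 * M < 2 * suc B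
  3M<2[B+1] = cube-cancel-< (begin-strict
    3 * M * (3 * M) * (3 * M)                    ≤⟨ m≤m+n _ ((13 + 8 * l) * (M * M * M)) ⟩
    3 * M * (3 * M) * (3 * M) + (13 + 8 * l) * (M * M * M)
                                                 ≡⟨ expand l M ⟩
    8 * (q * (M * M * M))                        <⟨ *-monoʳ-< 8 B³> ⟩
    8 * (suc B * suc B * suc B)                  ≡⟨ arrange B ⟩
    2 * suc B * (2 * suc B) * (2 * suc B)        ∎)
    where
    open ≤-Reasoning
    expand : ∀ l M → 3 * M * (3 * M) * (3 * M) + (13 + 8 * l) * (M * M * M) ≡ 8 * ((5 + l) * (M * M * M))
    expand = solve-∀
    arrange : ∀ B → 8 * (suc B * suc B * suc B) ≡ 2 * suc B * (2 * suc B) * (2 * suc B)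
    arrange = solve-∀

  AB≤qM² : A * B ≤ q * (M * M)
  AB≤qM² = cube-cancel-≤ (begin
    A * B * (A * B) * (A * B)                    ≡⟨ arrange₁ A B ⟩
    A * A * A * (B * B * B)                      ≤⟨ *-mono-≤ A³≤ B³≤ ⟩
    q * q * (M * M * M) * (q * (M * M * M))      ≡⟨ arrange₂ q M ⟩
    q * (M * M) * (q * (M * M)) * (q * (M * M))  ∎)
    where
    open ≤-Reasoning
    arrange₁ : ∀ A B → A * B * (A * B) * (A * B) ≡ A * A * A * (B * B * B)
    arrange₁ = solve-∀
    arrange₂ : ∀ q M → q * q * (M * M * M) * (q * (M * M * M)) ≡ q * (M * M) * (q * (M * M)) * (q * (M * M))
    arrange₂ = solve-∀

  B≤qM : B ≤ q * M
  B≤qM = cube-cancel-≤ (begin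
    B * B * B                        ≤⟨ B³≤ ⟩
    q * (M * M * M)                  ≤⟨ m≤m*n (q * (M * M * M)) (q * q) ⟩
    q * (M * M * M) * (q * q)        ≡⟨ arrange q M ⟩
    q * M * (q * M) * (q * M)        ∎)
    where
    open ≤-Reasoning
    arrange : ∀ q M → q * (M * M * M) * (q * q) ≡ q * M * (q * M) * (q * M)
    arrange = solve-∀

  5B≤M² : 5 * B ≤ M * M
  5B≤M² = begin
    5 * B        ≤⟨ *-monoʳ-≤ 5 B≤qM ⟩
    5 * (q * M)  ≡⟨ *-assoc 5 q M ⟨
    5 * q * M    ≤⟨ *-monoˡ-≤ M 5q≤M ⟩
    M * M        ∎
    where open ≤-Reasoning

  2B<3[A+1] : 2 * B < 3 * suc A
  2B<3[A+1] = *-mono-< {2} {3} ≤-refl (s≤s B≤A)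

  -- V / (3 M) approximates ∛(q²) - (2/3) ∛q.
  V : ℕ
  V = 3 * suc A ∸ 2 * B

  V+2B≡ : V + 2 * B ≡ 3 * suc A
  V+2B≡ = m∸n+n≡m (<⇒≤ 2B<3[A+1])

  -- In 15 (A + 1) - 10 B the bounds on `A` and `B` contribute 15 M with opposite signs, leaving 6 q
  -- M and a rounding constant.
  5V≤ : 5 * V ≤ 6 * (q * M) + 20
  5V≤ = ≤-by-certificate 0 (+-mono-≤ (≤-reflexive (cong (5 *_) V+2B≡)) (+-mono-≤ (*-monoʳ-≤ 3 5A≤) (*-monoʳ-≤ 5 3M<2[B+1])))
    (arrange V B A (q) M)
    where
    arrange : ∀ V B A q M →
      5 * V + (5 * (3 * suc A) + (3 * ((2 * q + 5) * M) + 5 * (2 * suc B))) + 0 ≡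
      6 * (q * M) + 20 + (5 * (V + 2 * B) + (3 * (5 * A) + 5 * suc (3 * M)))
    arrange = solve-∀

  -- In the cube of V + 2 B the mixed terms are 6 V B (V + 2 B), whose last factor is 3 (A + 1)
  -- again.
  27[A+1]³≡ : 27 * (suc A * suc A * suc A) ≡ 18 * (V * (B * suc A)) + 8 * (B * B * B) + V * V * V
  27[A+1]³≡ = begin
    27 * (suc A * suc A * suc A)                             ≡⟨ arrange₁ (suc A) ⟩
    3 * suc A * (3 * suc A) * (3 * suc A)                    ≡⟨ cong (λ n → n * n * n) V+2B≡ ⟨
    (V + 2 * B) * (V + 2 * B) * (V + 2 * B)                  ≡⟨ arrange₂ V B ⟩
    6 * (V * (B * (V + 2 * B))) + 8 * (B * B * B) + V * V * V
      ≡⟨ cong (λ n → 6 * (V * (B * n)) + 8 * (B * B * B) + V * V * V) V+2B≡ ⟩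
    6 * (V * (B * (3 * suc A))) + 8 * (B * B * B) + V * V * V ≡⟨ arrange₃ V B (suc A) ⟩
    18 * (V * (B * suc A)) + 8 * (B * B * B) + V * V * V     ∎
    where
    open ≡-Reasoning
    arrange₁ : ∀ a → 27 * (a * a * a) ≡ 3 * a * (3 * a) * (3 * a)
    arrange₁ = solve-∀
    arrange₂ : ∀ V B → (V + 2 * B) * (V + 2 * B) * (V + 2 * B) ≡
                       6 * (V * (B * (V + 2 * B))) + 8 * (B * B * B) + V * V * V
    arrange₂ = solve-∀
    arrange₃ : ∀ V B a → 6 * (V * (B * (3 * a))) + 8 * (B * B * B) + V * V * V ≡
                         18 * (V * (B * a)) + 8 * (B * B * B) + V * V * V
    arrange₃ = solve-∀

  -- Multiplied by 27 M³, the cubic inequality at 3 M y ≥ V contradicts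
  -- q² M³ < (A + 1)³: the terms in V³ cancel, and the bounds above reduce the rest
  -- to an inequality linear in M that fails for M ≥ 25.
  root-gap : ∀ {y} → 3 * suc A ≤ 3 * (M * y) + 2 * B →
    y * y * y + (6 + 2 * l) * y + (7 + 2 * l) ≤ q * (4 + l) → ⊥
  root-gap {y} bound cubic = <⇒≱ divided (≤-by-certificate (1000 * M + 637 * (l * M) + 800 * l + 40)
      (*-monoʳ-≤ 160 5q≤M) (finish l M))
    where
    Y = 3 * (M * y)

    V≤Y : V ≤ Y
    V≤Y = +-cancelʳ-≤ (2 * B) V Y (≤-trans (≤-reflexive V+2B≡) bound)

    scaled-cubic : V * V * V + 18 * (M * M * (3 + l)) * V + 27 * (M * M * M * (7 + 2 * l)) ≤
                   27 * (M * M * M * (q * (4 + l)))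
    scaled-cubic = begin
      V * V * V + 18 * (M * M * (3 + l)) * V + 27 * (M * M * M * (7 + 2 * l))
        ≤⟨ +-monoˡ-≤ (27 * (M * M * M * (7 + 2 * l)))
             (+-mono-≤ (*-mono-≤ (*-mono-≤ V≤Y V≤Y) V≤Y) (*-monoʳ-≤ (18 * (M * M * (3 + l))) V≤Y)) ⟩
      Y * Y * Y + 18 * (M * M * (3 + l)) * Y + 27 * (M * M * M * (7 + 2 * l))
        ≡⟨ expand l M y ⟩
      27 * (M * M * M * (y * y * y + (6 + 2 * l) * y + (7 + 2 * l)))
        ≤⟨ *-monoʳ-≤ 27 (*-monoʳ-≤ (M * M * M) cubic) ⟩
      27 * (M * M * M * (q * (4 + l))) ∎
      where
      open ≤-Reasoning
      expand : ∀ l M y → let Y = 3 * (M * y) in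
        Y * Y * Y + 18 * (M * M * (3 + l)) * Y + 27 * (M * M * M * (7 + 2 * l)) ≡
        27 * (M * M * M * (y * y * y + (6 + 2 * l) * y + (7 + 2 * l)))
      expand = solve-∀

    -- The M³ terms combine as 27 (q² - q (q - 1) + 2 q - 3) = 81 (q - 1), with q - 1 = 4 + l.
    eliminate-V³ : 18 * (M * M * (3 + l)) * V + 81 * (M * M * M * (4 + l)) <
                   18 * (V * (B * suc A)) + 8 * (B * B * B)
    eliminate-V³ = ≤-by-certificate 0
      (+-mono-≤ scaled-cubic (≤-trans (*-monoʳ-< 27 A³>) (≤-reflexive 27[A+1]³≡)))
      (arrange l M V (18 * (V * (B * suc A))) (8 * (B * B * B)) (V * V * V))
      where
      arrange : ∀ l M V s t c → let q = 5 + l ; W = 18 * (M * M * (3 + l)) * V in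
        suc (W + 81 * (M * M * M * (4 + l))) + (27 * (M * M * M * (q * (4 + l))) + (s + t + c)) + 0 ≡
        s + t + (c + W + 27 * (M * M * M * (7 + 2 * l)) + suc (27 * (q * q * (M * M * M))))
      arrange = solve-∀

    -- Replacing A B by q M² leaves the coefficient 18 q - 18 (3 + l) = 36 of M² V.
    eliminate-A : 81 * (M * M * M * (4 + l)) < 36 * (M * M * V) + 18 * (V * B) + 8 * (q * (M * M * M))
    eliminate-A = ≤-by-certificate 0
      (+-mono-≤ eliminate-V³ (+-mono-≤ (*-monoʳ-≤ (18 * V) AB≤qM²) (*-monoʳ-≤ 8 B³≤)))
      (arrange l M V A B (8 * (B * B * B)))
      where
      arrange : ∀ l M V A B t → let q = 5 + l in
        suc (81 * (M * M * M * (4 + l))) +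
          (18 * (V * (B * suc A)) + t + (18 * V * (q * (M * M)) + 8 * (q * (M * M * M)))) + 0 ≡
        36 * (M * M * V) + 18 * (V * B) + 8 * (q * (M * M * M)) +
          (suc (18 * (M * M * (3 + l)) * V + 81 * (M * M * M * (4 + l))) + (18 * V * (A * B) + t))
      arrange = solve-∀

    -- The factor 25 prepares for the bounds on 5 V and 5 B: 180 + 18 copies of 6 q M + 20, together
    -- with 200 q M, give the right-hand side.
    divided : 2025 * (M * (4 + l)) < 1388 * (q * M) + 3960
    divided = *-cancelˡ-< (M * M) _ _ (≤-by-certificate 24 
      (+-mono-≤ (*-monoʳ-≤ 25 eliminate-A)
        (+-mono-≤ (*-monoʳ-≤ (180 * (M * M)) 5V≤) (*-monoʳ-≤ 18 (*-mono-≤ 5V≤ 5B≤M²))))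
      (arrange l M V B))
      where
      arrange : ∀ l M V B → let q = 5 + l ; R = 6 * (q * M) + 20 in
        suc (M * M * (2025 * (M * (4 + l)))) +
          (25 * (36 * (M * M * V) + 18 * (V * B) + 8 * (q * (M * M * M))) +
            (180 * (M * M) * R + 18 * (R * (M * M)))) + 24 ≡
        M * M * (1388 * (q * M) + 3960) +
          (25 * suc (81 * (M * M * M * (4 + l))) +
            (180 * (M * M) * (5 * V) + 18 * (5 * V * (5 * B))))
      arrange = solve-∀

    finish : ∀ l M → let q = 5 + l in
      1388 * (q * M) + 3960 + 160 * M + (1000 * M + 637 * (l * M) + 800 * l + 40) ≡
      2025 * (M * (4 + l)) + 160 * (5 * q)
    finish = solve-∀

-- Passage to real numbers

+/1-homo : ∀ m n → (+ (m + n)) / 1 ℚ.≃ + m / 1 ℚ.+ + n / 1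
+/1-homo m n = ℚ.*≡* (identity (+ m) (+ n))
  where
  identity : ∀ m n → (m ℤ.+ n) ℤ.* + 1 ≡ (m ℤ.* + 1 ℤ.+ n ℤ.* + 1) ℤ.* + 1
  identity = ℤ-Solver.solve-∀

/1-mono : ∀ {m n} → m ≤ n → + m / 1 ℚ.≤ + n / 1
/1-mono m≤n = ℚ.*≤* (ℤ.*-monoʳ-≤-nonNeg (+ 1) (ℤ.+≤+ m≤n))

1/suc≤ : ∀ {ε} → ℚ.0ℚᵘ ℚ.< ε → ∃ λ d → ∀ n → d ≤ n → + 1 / suc n ℚ.≤ ε
1/suc≤ {ℚ.mkℚᵘ +[1+ a ] d} _ = d , λ n d≤n → ℚ.*≤* (ℤ.+≤+
  (≤-trans (≤-reflexive (*-identityˡ (suc d))) (≤-trans (s≤s d≤n) (m≤n*m (suc n) (suc a)))))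
1/suc≤ {ℚ.mkℚᵘ (+ 0) d} (ℚ.*<* (ℤ.+<+ ()))
1/suc≤ {ℚ.mkℚᵘ ℤ.-[1+ a ] d} (ℚ.*<* ())

clear-denominators : ∀ A B m y →
  + A / suc m ℚ.+ + 1 / suc m ℚ.≤ + y / 1 ℚ.+ + 2 / 3 ℚ.* (+ B / suc m) →
  3 * suc A ≤ 3 * (suc m * y) + 2 * B
clear-denominators A B m y h = *-cancelʳ-≤ _ _ M (ℤ.drop‿+≤+
  (subst₂ ℤ._≤_ left right (ℚ.drop-*≤* h′)))
  where
  M = suc m
  numerator : ℕ
  numerator = 3 * (M * y) + 2 * B

  lhs≃ : + A / M ℚ.+ + 1 / M ℚ.≃ + suc A / M
  lhs≃ = ℚ.*≡* (trans (identity (+ A) (+ M)) (cong (+ suc A ℤ.*_) (sym (ℤ.pos-* M M))))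
    where
    identity : ∀ A M → (A ℤ.* M ℤ.+ + 1 ℤ.* M) ℤ.* M ≡ (+ 1 ℤ.+ A) ℤ.* (M ℤ.* M)
    identity = ℤ-Solver.solve-∀

  rhs≃ : + y / 1 ℚ.+ + 2 / 3 ℚ.* (+ B / M) ℚ.≃ + numerator / (3 * M)
  rhs≃ = ℚ.*≡* (cong₂ ℤ._*_ numerators (cong +_ (sym (*-identityˡ (3 * M)))))
    where
    commute : ∀ M y → 3 * (M * y) ≡ y * (3 * M)
    commute = solve-∀
    numerators : + y ℤ.* + (3 * M) ℤ.+ + 2 ℤ.* + B ℤ.* + 1 ≡ + numerator
    numerators = cong₂ ℤ._+_ (trans (sym (ℤ.pos-* y (3 * M))) (cong +_ (sym (commute M y))))
      (trans (ℤ.*-identityʳ (+ 2 ℤ.* + B)) (sym (ℤ.pos-* 2 B)))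

  h′ : + suc A / M ℚ.≤ + numerator / (3 * M)
  h′ = ℚ.≤-respˡ-≃ lhs≃ (ℚ.≤-respʳ-≃ rhs≃ h)

  left : + suc A ℤ.* + (3 * M) ≡ + (3 * suc A * M)
  left = trans (sym (ℤ.pos-* (suc A) (3 * M))) (cong +_ (commute (suc A) M))
    where
    commute : ∀ a M → a * (3 * M) ≡ 3 * a * M
    commute = solve-∀

  right : + numerator ℤ.* + M ≡ + (numerator * M)
  right = sym (ℤ.pos-* numerator M)

-- The last hypothesis is the violated bound at one index, with margin ε. As n = q² - q + 1 + y,
-- everything but the roots cancels. Taking δ = 1/M will raise A/M to (A + 1)/M, which exceeds
-- ∛(q²).
isolate-roots : ∀ {q² q N n y a b ε δ} →
  + N / 1 ℚ.≤ + n / 1 → n + q ≡ q² + 1 + y → δ ℚ.≤ ε →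
  + q² / 1 ℚ.+ ℚ.- ℚ.1ℚᵘ ℚ.* (+ q / 1) ℚ.+ a ℚ.+
    ℚ.- ℚ.1ℚᵘ ℚ.* ((+ 2 / 3) ℚ.* b) ℚ.+ + 1 / 1 ℚ.+ ε ℚ.≤ + N / 1 →
  a ℚ.+ δ ℚ.≤ + y / 1 ℚ.+ + 2 / 3 ℚ.* b
isolate-roots {q²} {q} {N} {n} {y} {a} {b} {ε} {δ} N≤n n+q≡ δ≤ε h = begin
  a ℚ.+ δ
    ≤⟨ ℚ.+-monoʳ-≤ a δ≤ε ⟩
  a ℚ.+ ε
    ≃⟨ solve 5 (λ Q² Q a c ε → a :+ ε :=
         (Q² :+ :- con ℚ.1ℚᵘ :* Q :+ a :+ :- con ℚ.1ℚᵘ :* c :+ con ℚ.1ℚᵘ :+ ε) :+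
         (Q :- Q² :- con ℚ.1ℚᵘ :+ c))
         ℚ.≃-refl (+ q² / 1) (+ q / 1) a c ε ⟩
  bound ℚ.+ shift
    ≤⟨ ℚ.+-monoˡ-≤ shift (ℚ.≤-trans h N≤n) ⟩
  + n / 1 ℚ.+ shift
    ≃⟨ solve 4 (λ n Q Q² c →
         n :+ (Q :- Q² :- con ℚ.1ℚᵘ :+ c) := (n :+ Q) :+ (:- Q² :- con ℚ.1ℚᵘ :+ c))
         ℚ.≃-refl (+ n / 1) (+ q / 1) (+ q² / 1) c ⟩
  (+ n / 1 ℚ.+ + q / 1) ℚ.+ shift′
    ≃⟨ ℚ.+-congˡ shift′ sum≃ ⟩
  (+ q² / 1 ℚ.+ + 1 / 1 ℚ.+ + y / 1) ℚ.+ shift′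
    ≃⟨ solve 3 (λ Q² y c →
         (Q² :+ con ℚ.1ℚᵘ :+ y) :+ (:- Q² :- con ℚ.1ℚᵘ :+ c) := y :+ c)
         ℚ.≃-refl (+ q² / 1) (+ y / 1) c ⟩
  + y / 1 ℚ.+ c ∎
  where
  open ℚ.≤-Reasoning
  open ℚ.+-*-Solver
  c bound shift shift′ : ℚ.ℚᵘ
  c      = + 2 / 3 ℚ.* b
  bound  = + q² / 1 ℚ.+ ℚ.- ℚ.1ℚᵘ ℚ.* (+ q / 1) ℚ.+ a ℚ.+ ℚ.- ℚ.1ℚᵘ ℚ.* c ℚ.+ + 1 / 1 ℚ.+ ε
  shift  = + q / 1 ℚ.- + q² / 1 ℚ.- ℚ.1ℚᵘ ℚ.+ c
  shift′ = ℚ.- (+ q² / 1) ℚ.- ℚ.1ℚᵘ ℚ.+ c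

  sum≃ : + n / 1 ℚ.+ + q / 1 ℚ.≃ + q² / 1 ℚ.+ + 1 / 1 ℚ.+ + y / 1
  sum≃ = ℚ.≃-trans (ℚ.≃-sym (+/1-homo n q))
    (ℚ.≃-trans (ℚ.≃-reflexive (cong (λ k → + k / 1) n+q≡))
    (ℚ.≃-trans (+/1-homo (q² + 1) y) (ℚ.+-congˡ (+ y / 1) (+/1-homo q² 1))))

approximation-absurd : ∀ {q l N y m A B ε} → q ≡ 5 + l → N ≤ q * (4 + l) + suc y →
  (1 ≤ y → y * y * y + (6 + 2 * l) * y + (7 + 2 * l) ≤ q * (4 + l)) →
  5 * q ≤ m → + 1 / suc m ℚ.≤ ε →
  (A ^ 3 ≤ q ^ 2 * suc m ^ 3 × q ^ 2 * suc m ^ 3 < suc A ^ 3) →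
  (B ^ 3 ≤ q * suc m ^ 3 × q * suc m ^ 3 < suc B ^ 3) →
  + (q ^ 2) / 1 ℚ.+ ℚ.- ℚ.1ℚᵘ ℚ.* (+ q / 1) ℚ.+ + A / suc m ℚ.+
    ℚ.- ℚ.1ℚᵘ ℚ.* ((+ 2 / 3) ℚ.* (+ B / suc m)) ℚ.+ + 1 / 1 ℚ.+ ε ℚ.≤ + N / 1 → ⊥
approximation-absurd {q} {l} {N} {y} {m} {A} {B} {ε} refl N≤ cubic 5q≤m 1/M≤ε (A³≤ , A³>) (B³≤ , B³>) h =
  absurd y bound cubic
  where
  M : ℕ
  M = suc m

  q²M³≡ : q ^ 2 * M ^ 3 ≡ q * q * (M * M * M)
  q²M³≡ = cong₂ (λ c d → q * c * d) (*-identityʳ q) (cube M)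

  qM³≡ : q * M ^ 3 ≡ q * (M * M * M)
  qM³≡ = cong (q *_) (cube M)

  open ScaledRoots {l} {M} {A} {B} (m≤n⇒m≤1+n 5q≤m)
    (subst₂ _≤_ (cube A) q²M³≡ A³≤) (subst₂ _<_ q²M³≡ (cube (suc A)) A³>)
    (subst₂ _≤_ (cube B) qM³≡ B³≤) (subst₂ _<_ qM³≡ (cube (suc B)) B³>)
    using (2B<3[A+1]; root-gap)

  bound : 3 * suc A ≤ 3 * (M * y) + 2 * B
  bound = clear-denominators A B m y (isolate-roots {q ^ 2} {q} {N} {q * (4 + l) + suc y} {y}
    {+ A / M} {+ B / M} {ε} {+ 1 / M} (/1-mono N≤) (expand l y) 1/M≤ε h)
    where
    expand : ∀ l y → (5 + l) * (4 + l) + suc y + (5 + l) ≡ (5 + l) * ((5 + l) * 1) + 1 + y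
    expand = solve-∀

  -- For y = 0 the bound says 3 (A + 1) ≤ 2 B, against B ≤ A; the cubic is available from y = 1 on.
  absurd : ∀ y → 3 * suc A ≤ 3 * (M * y) + 2 * B →
    (1 ≤ y → y * y * y + (6 + 2 * l) * y + (7 + 2 * l) ≤ q * (4 + l)) → ⊥
  absurd zero    bound _     = <⇒≱ 2B<3[A+1]
    (≤-trans bound (≤-reflexive (cong (λ n → 3 * n + 2 * B) (*-zeroʳ M))))
  absurd (suc y) bound cubic = root-gap {suc y} bound (cubic (s≤s z≤n))

bounded-by-roots : ∀ {q l N y} → q ≡ 5 + l → N ≤ q * (4 + l) + suc y →
  (1 ≤ y → y * y * y + (6 + 2 * l) * y + (7 + 2 * l) ≤ q * (4 + l)) →
  fromℕ N ≤ᴿ fromℕ (q ^ 2) -ᴿ fromℕ q +ᴿ ∛ (q ^ 2) -ᴿ (+ 2 / 3) ·ᴿ ∛ q +ᴿ fromℕ 1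
bounded-by-roots {q} {l} {N} {y} q≡5+l N≤ cubic (ε , 0<ε , n₀ , below) with d , 1/suc≤ε ← 1/suc≤ 0<ε =
  approximation-absurd {q} {l} {N} {y} {m} {⌊∛ q ^ 2 * suc m ^ 3 ⌋} {⌊∛ q * suc m ^ 3 ⌋} {ε}
    q≡5+l N≤ cubic (m≤n+m (5 * q) (n₀ + d))
    (1/suc≤ε m (≤-trans (m≤n+m d n₀) (m≤m+n (n₀ + d) (5 * q))))
    (⌊∛⌋-bounds (q ^ 2 * suc m ^ 3)) (⌊∛⌋-bounds (q * suc m ^ 3))
    (below m (≤-trans (m≤m+n n₀ d) (m≤m+n (n₀ + d) (5 * q))))
  where
  -- The index lies beyond `n₀`, where the margin ε holds, beyond `d`, so that 1/(m + 1) ≤ ε, and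
  -- beyond 5 q, as the root estimates require.
  m : ℕ
  m = n₀ + d + 5 * q

-- The cases q = 3, q = 4 and q ≥ 5

pencil-or-size-bound : ∀ {p} (U : Unital (suc p)) {S} → Unital.IsMaximalEKR U S →
  (∣ S ∣ ≡ suc p ^ 2 × Unital.IsPointPencil U S) ⊎ SizeBound p ∣ S ∣
pencil-or-size-bound U maximal with PointPencils.pencil-or-avoidable U maximal
... | inj₁ (_ , common) = inj₁ (PointPencils.pencil U maximal common)
... | inj₂ avoid        = inj₂ (NoCommonPoint.size-bound U (proj₁ maximal) avoid)

-- For q = 3 the cubic fails at x = 3, where it reads 42 ≤ 33; at x = 2 it holds with equality, 18
-- on both sides.
excess≤2 : ∀ x {u} → x ≤ 3 → suc u * x + 3 * x ≤ 6 + x + x * x →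
  x * 6 + suc u ≤ suc u * suc u → x ≤ 2
excess≤2 3 {u} x≤3 linear quadratic =
  contradiction (cubic-bound {2} {3} {u} (s≤s z≤n) x≤3 linear quadratic) (from-no (42 ≤? 33))
excess≤2 0 _ _ _ = z≤n
excess≤2 1 _ _ _ = s≤s z≤n
excess≤2 2 _ _ _ = ≤-refl
excess≤2 (suc (suc (suc (suc _)))) (s≤s (s≤s (s≤s ())))

excess≤1 : ∀ x {u} → x ≤ 4 → suc u * x + 4 * x ≤ 12 + x + x * x →
  x * 12 + suc u ≤ suc u * suc u → x ≤ 1
excess≤1 0 _ _ _ = z≤n
excess≤1 1 _ _ _ = ≤-refl
-- The cubic still allows x = 2, as 22 ≤ 24, so integrality of u is used: the linear bound gives
-- `suc u` ≤ 5, and then 24 ≤ 4 · 5.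
excess≤1 2 {u} _ linear quadratic = contradiction (begin
  24         ≤⟨ +-cancelˡ-≤ (suc u) 24 (u * suc u) (≤-trans (≤-reflexive (+-comm (suc u) 24)) quadratic) ⟩
  u * suc u  ≤⟨ *-mono-≤ (≤-pred 1+u≤5) 1+u≤5 ⟩
  20         ∎) (from-no (24 ≤? 20))
  where
  open ≤-Reasoning
  1+u≤5 : suc u ≤ 5
  1+u≤5 = *-cancelʳ-≤ (suc u) 5 2 (+-cancelʳ-≤ 8 (suc u * 2) 10 linear)
excess≤1 3 {u} x≤4 linear quadratic =
  contradiction (cubic-bound {3} {3} {u} (s≤s z≤n) x≤4 linear quadratic) (from-no (48 ≤? 39))
excess≤1 4 {u} x≤4 linear quadratic =
  contradiction (cubic-bound {3} {4} {u} (s≤s z≤n) x≤4 linear quadratic) (from-no (92 ≤? 60))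
excess≤1 (suc (suc (suc (suc (suc _))))) (s≤s (s≤s (s≤s (s≤s ()))))

≤-by-excess : ∀ {N} c {x₀} → (∀ x → 1 ≤ x → N ≡ c + x → x ≤ x₀) → N ≤ c + x₀
≤-by-excess {N} c {x₀} x≤x₀ with N ≤? c
... | yes N≤c = ≤-trans N≤c (m≤m+n c x₀)
... | no  N≰c with d , refl ← m≤n⇒∃[o]m+o≡n (≰⇒> N≰c) = begin
  suc c + d  ≡⟨ +-suc c d ⟨
  c + suc d  ≤⟨ +-monoʳ-≤ c (x≤x₀ (suc d) (s≤s z≤n) (sym (+-suc c d))) ⟩
  c + x₀     ∎
  where open ≤-Reasoning

size≤8 : ∀ {N} → SizeBound 2 N → N ≤ 8
size≤8 bound = ≤-by-excess 6 λ x 1≤x N≡ →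
  [ (λ full → *-cancelʳ-≤ x 2 6 (+-cancelʳ-≤ 4 (x * 6) 12 full))
  , (λ (x≤3 , _ , linear , quadratic) → excess≤2 x x≤3 linear quadratic)
  ]′ (bound x 1≤x N≡)

size≤13 : ∀ {N} → SizeBound 3 N → N ≤ 13
size≤13 bound = ≤-by-excess 12 λ x 1≤x N≡ →
  [ (λ full → ≤-pred (*-cancelʳ-< 12 x 2 (s≤s (≤-trans (+-cancelʳ-≤ 5 (x * 12) 20 full) (m≤m+n 20 3)))))
  , (λ (x≤4 , _ , linear , quadratic) → excess≤1 x x≤4 linear quadratic)
  ]′ (bound x 1≤x N≡)

-- Substituting x = y + 1 removes the square term of the cubic; this shift is the source of the
-- final + 1 in the root bound. A point on q + 1 blocks would force x ≤ 1, while here x ≥ 2.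
excess-cubic : ∀ {l N y} → SizeBound (4 + l) N → 1 ≤ y → N ≡ (5 + l) * (4 + l) + suc y →
  y * y * y + (6 + 2 * l) * y + (7 + 2 * l) ≤ (5 + l) * (4 + l)
excess-cubic {l} {y = y} bound 1≤y N≡ with bound (suc y) (s≤s z≤n) N≡
... | inj₂ (x≤q , u , linear , quadratic) =
  ≤-by-certificate 0 (cubic-bound {4 + l} {suc y} {u} (s≤s z≤n) x≤q linear quadratic) (expand l y)
  where
  expand : ∀ l y → let q = 5 + l ; x = suc y in
    y * y * y + (6 + 2 * l) * y + (7 + 2 * l) + (3 * (x * x) + q * (4 + l)) + 0 ≡
    q * (4 + l) + (x * x * x + (q + (4 + l)) * x)
  expand = solve-∀
... | inj₁ full = contradiction full (<⇒≱ (begin-strict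
  (q + 1) * (q + 1)                              <⟨ m≤m+n _ (9 + 7 * l + l * l) ⟩
  suc ((q + 1) * (q + 1)) + (9 + 7 * l + l * l)  ≡⟨ expand l ⟩
  2 * (q * (4 + l)) + (q + 1)                    ≤⟨ +-monoˡ-≤ (q + 1) (*-monoˡ-≤ (q * (4 + l)) (s≤s 1≤y)) ⟩
  suc y * (q * (4 + l)) + (q + 1)                ∎))
  where
  open ≤-Reasoning
  q = 5 + l
  expand : ∀ l → let q = 5 + l in
    suc ((q + 1) * (q + 1)) + (9 + 7 * l + l * l) ≡ 2 * (q * (4 + l)) + (q + 1)
  expand = solve-∀

size≤root-bound : ∀ {q l N} → q ≡ 5 + l → SizeBound (4 + l) N →
  fromℕ N ≤ᴿ fromℕ (q ^ 2) -ᴿ fromℕ q +ᴿ ∛ (q ^ 2) -ᴿ (+ 2 / 3) ·ᴿ ∛ q +ᴿ fromℕ 1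
size≤root-bound {q} {l} {N} q≡5+l bound = bounded-by-roots q≡5+l
  (≤-trans (m≤n+m∸n N (suc c)) (≤-reflexive (sym (+-suc c y)))) (cubic q≡5+l)
  where
  c y : ℕ
  c = q * (4 + l)
  -- Truncated subtraction gives N ≤ c + suc y in all cases. For y ≥ 1, where the cubic is needed,
  -- it is exact.
  y = N ∸ suc c

  cubic : q ≡ 5 + l → 1 ≤ y → y * y * y + (6 + 2 * l) * y + (7 + 2 * l) ≤ q * (4 + l)
  cubic refl 1≤y = excess-cubic {l} bound 1≤y (trans (sym (m+[n∸m]≡n c<N)) (sym (+-suc c y)))
    where
    c<N : c < N
    c<N = <⇒≤ (m∸n≢0⇒n<m λ y≡0 → <⇒≢ 1≤y (sym y≡0))

theorem6p4 : (q : ℕ) (U : Unital q) (S : Subset (Unital.b U)) → Unital.IsMaximalEKR U S →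
    (5 ≤ q →
    (∣ S ∣ ≡ q ^ 2 × Unital.IsPointPencil U S) ⊎
    (fromℕ ∣ S ∣ ≤ᴿ fromℕ (q ^ 2) -ᴿ fromℕ q +ᴿ ∛ (q ^ 2) -ᴿ (+ 2 / 3) ·ᴿ ∛ q +ᴿ fromℕ 1)) ×
    (q ≡ 4 →
    (∣ S ∣ ≡ 16 × 16 ≡ q ^ 2 × Unital.IsPointPencil U S) ⊎
    (∣ S ∣ ≤ 13 × 13 ≡ q ^ 2 ∸ q + 1)) ×
    (q ≡ 3 →
    (∣ S ∣ ≡ 9 × 9 ≡ q ^ 2 × Unital.IsPointPencil U S) ⊎
    ∣ S ∣ ≤ 8)
theorem6p4 q U S maximal = q≥5 U maximal , q≡4 U maximal , q≡3 U maximal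
  where
  q≥5 : ∀ {q} (U : Unital q) {S} → Unital.IsMaximalEKR U S → 5 ≤ q →
    (∣ S ∣ ≡ q ^ 2 × Unital.IsPointPencil U S) ⊎
    (fromℕ ∣ S ∣ ≤ᴿ fromℕ (q ^ 2) -ᴿ fromℕ q +ᴿ ∛ (q ^ 2) -ᴿ (+ 2 / 3) ·ᴿ ∛ q +ᴿ fromℕ 1)
  q≥5 U {S} maximal 5≤q with l , refl ← m≤n⇒∃[o]m+o≡n 5≤q =
    map₂ (size≤root-bound refl) (pencil-or-size-bound U maximal)

  q≡4 : ∀ {q} (U : Unital q) {S} → Unital.IsMaximalEKR U S → q ≡ 4 →
    (∣ S ∣ ≡ 16 × 16 ≡ q ^ 2 × Unital.IsPointPencil U S) ⊎ (∣ S ∣ ≤ 13 × 13 ≡ q ^ 2 ∸ q + 1)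
  q≡4 U maximal refl = map (λ (size , pencil) → size , refl , pencil)
    (λ bound → size≤13 bound , refl) (pencil-or-size-bound U maximal)

  q≡3 : ∀ {q} (U : Unital q) {S} → Unital.IsMaximalEKR U S → q ≡ 3 →
    (∣ S ∣ ≡ 9 × 9 ≡ q ^ 2 × Unital.IsPointPencil U S) ⊎ ∣ S ∣ ≤ 8
  q≡3 U maximal refl = map (λ (size , pencil) → size , refl , pencil)
    size≤8 (pencil-or-size-bound U maximal)
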